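{- For all integers $1\le n<r$, $$|B_x(n,r)|\ \le\ 1+\sum_{i=1}^{n}\binom{n}{i}\left[\,2\binom{r+2^i-1}{r}\Big/ i!\;-\;\binom{r+2^{i-1}-1}{r}\Big/(i-1)!\,\right].$$
   Context: Let $I$ (left vertices) and $O$ (right vertices) be disjoint finite sets with $|I|=n$ and $|O|=r$. An $(n,r)$-bipartite graph is $G=(I\oplus O,E)$ with edge set $E\subseteq I\times O$. The connected domain $I_c(G)$ is the set of vertices of $I$ with nonzero degree in $G$. Two $(n,r)$-bipartite graphs $G_1=(I\oplus O,E_1)$ and $G_2=(I\oplus O,E_2)$ are left-set-labeled equivalent if there exist bijections $\alpha:I\to I$ and $\beta:O\to O$ such that for all $x\in I,y\in O$, $(x,y)\in E_1$ iff $(\alpha(x),\beta(y))\in E_2$, and moreover $I_c(G_1)=I_c(G_2)$. $B_x(n,r)$ denotes the set of equivalence classes of $(n,r)$-bipartite graphs under left-set-labeled equivalence. -}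

module Defs where

open import Data.Nat using (ℕ; zero; suc; _+_; _*_; _∸_; _^_; _<_; _≤_)
open import Data.Nat.Combinatorics using (_C_)
open import Data.Nat.Properties using (_!≢0)
open import Data.Nat using (_!)
open import Data.Integer using (+_)
open import Data.Fin using (Fin)
open import Data.Fin.Permutation using (Permutation′; _⟨$⟩ʳ_)
open import Data.Bool using (Bool; true)
open import Data.Product using (∃; _×_; Σ)
open import Function.Bundles using (_⇔_)
open import Relation.Binary.PropositionalEquality using (_≡_)
import Data.Rational as ℚ
open ℚ using (ℚ)

-- An (n,r)-bipartite graph with I = Fin n, O = Fin r:
-- (x , y) ∈ E  iff  E x y ≡ true.
BGraph : ℕ → ℕ → Set
BGraph n r = Fin n → Fin r → Bool

InConnDom : ∀ {n r} → BGraph n r → Fin n → Set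
InConnDom G x = ∃ λ y → G x y ≡ true

LSLEquiv : ∀ {n r} → BGraph n r → BGraph n r → Set
LSLEquiv {n} {r} G₁ G₂ =
  (Σ (Permutation′ n) λ α → Σ (Permutation′ r) λ β →
     ∀ x y → (G₁ x y ≡ true) ⇔ (G₂ (α ⟨$⟩ʳ x) (β ⟨$⟩ʳ y) ≡ true))
  × (∀ x → InConnDom G₁ x ⇔ InConnDom G₂ x)

fromℕ : ℕ → ℚ
fromℕ k = (+ k) ℚ./ 1

-- |B_x(n,r)| ≤ N : every family of pairwise inequivalent graphs has
-- at most N members (i.e. the quotient has at most N classes).
ClassCount≤ : ℕ → ℕ → ℚ → Set
ClassCount≤ n r N =
  ∀ (k : ℕ) (G : Fin k → BGraph n r) →
    (∀ i j → LSLEquiv (G i) (G j) → i ≡ j) →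
    fromℕ k ℚ.≤ N

-- summand for index i = suc j (so (i-1)! = j!):
-- C(n,i) * [ 2 C(r+2^i-1, r) / i!  -  C(r+2^(i-1)-1, r) / (i-1)! ]
summand : ℕ → ℕ → ℕ → ℚ
summand n r j =
  fromℕ (n C suc j) ℚ.*
    ( ((+ (2 * ((r + 2 ^ suc j ∸ 1) C r))) ℚ./ (suc j !)) {{suc j !≢0}}
      ℚ.- ((+ ((r + 2 ^ j ∸ 1) C r)) ℚ./ (j !)) {{j !≢0}} )

sumTo : ℕ → ℕ → ℕ → ℚ
sumTo n r zero = ℚ.0ℚ
sumTo n r (suc m) = sumTo n r m ℚ.+ summand n r m

bound : ℕ → ℕ → ℚ
bound n r = ℚ.1ℚ ℚ.+ sumTo n r n

{-# OPTIONS --safe #-}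
module Submission where

-- Fix the connected domain, of size i. The classes are then the orbits of S_i × S_r on the i × r matrices without
-- zero row. By Burnside, i! r! times their number is the number of triples (σ, β, M) with M fixed by (σ, β) and
-- without zero row. At least i r! C(r + 2^(i-1) - 1, r) fixed triples have a zero row: insert a zero row into a matrix
-- fixed by β, and let σ swap the new row with some chosen zero row. So it remains to bound the number of all fixed
-- triples by 2 r! C(r + 2^i - 1, r), the identity σ alone contributing half of this.
--
-- For given σ the pairs (β, M) are weighted permutations β: a cycle of length l has as weight the number of columns
-- fixed by σ^l. That is 2^z for l = 1, where z is the number of cycles of σ, and at most 2^i for l > 1. With 2^i
-- as weight for all l > 1 the sum H(r) over all β satisfies H(r + 1) = (2^z + r) H(r) + r (2^i - 2^z) H(r - 1). The sum of H(r) over σ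
-- grows at most as fast in r as the required bound does, so that only r = i + 1 matters. There the inequality is checked by
-- evaluation for i < 50, and for i >= 50 it follows from H(r) <= (3/4)^(m r) 2^i (2^i + 1) ... (2^i + r - 1) with m = i - z.

open import Defs
open import Data.Nat hiding (_≟_; _/_)
open import Data.Nat.Properties hiding (_≟_; suc-injective)
open import Data.Nat.Combinatorics using (_C_; nCk+nC[k+1]≡[n+1]C[k+1]; nCk≡n!/k![n-k]!; k![n∸k]!∣n!; k>n⇒nCk≡0; nCn≡1; nCk≡nC[n∸k])
open import Data.Nat.DivMod using (_/_; m*[n/m]≡n)
open import Data.Nat.Tactic.RingSolver using (solve-∀)
open import Data.Integer using (+≤+)
import Data.Integer as ℤ
import Data.Integer.Properties as ℤ
open import Data.Rational using (ℚ; 0ℚ; 1ℚ)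
import Data.Rational as ℚ
import Data.Rational.Properties as ℚ
open import Data.Rational.Solver using (module +-*-Solver)
open import Data.Rational.Unnormalised using (mkℚᵘ; *≡*; *≤*)
import Data.Rational.Unnormalised.Properties as ℚᵘ
open import Data.Bool using (Bool; true; false; T; _∧_; if_then_else_) renaming (_≟_ to _≟ᵇ_)
open import Data.Bool.Properties using (T-∧; ¬-not)
open import Data.Fin using (Fin; zero; suc)
open import Data.Fin.Properties using (_≟_; all?; any?; suc-injective)
open import Data.Fin.Permutation using (Permutation′; permutation; _⟨$⟩ʳ_; _⟨$⟩ˡ_; _∘ₚ_; lift₀; transpose; remove; lift₀-remove; lift₀-cong; inverseˡ; inverseʳ) renaming (id to idₚ; flip to flipₚ; _≈_ to _≈ₚ_)
open import Data.List using (List; []; _∷_; _++_; map; length; filter; cartesianProduct; cartesianProductWith; allFin; applyUpTo) renaming (tabulate to tabulateᴸ)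
open import Data.List.Properties using (length-tabulate; length-++-sucʳ)
open import Data.List.Membership.Propositional using (_∈_; lose)
open import Data.List.Membership.Propositional.Properties using (∈-cartesianProductWith⁺; ∈-cartesianProduct⁺; ∈-cartesianProduct⁻; ∈-allFin; ∈-filter⁺; ∈-filter⁻; ∈-∃++)
open import Data.List.Relation.Unary.All using (All; []; _∷_) renaming (lookup to lookupᴬ)
open import Data.List.Relation.Unary.All.Properties using (All¬⇒¬Any)
open import Data.List.Relation.Unary.AllPairs using ([]; _∷_)
open import Data.List.Relation.Unary.Any using (here; there; satisfied) renaming (any? to anyᴸ?)
open import Data.List.Relation.Unary.Unique.Propositional using (Unique)
open import Data.List.Relation.Unary.Unique.Propositional.Properties using (cartesianProductWith⁺; cartesianProduct⁺; allFin⁺) renaming (filter⁺ to Unique-filter⁺)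
open import Data.Product using (_×_; _,_; proj₁; proj₂; ∃)
open import Data.Sum using (_⊎_; inj₁; inj₂)
open import Data.Unit using (⊤; tt)
open import Data.Vec using (Vec; []; _∷_; lookup; _[_]≔_; tabulate; replicate; insertAt; removeAt; head; tail) renaming (map to mapᵛ)
open import Data.Vec.Properties using (≡-dec; lookup∘tabulate; tabulate∘lookup; tabulate-cong; lookup-map; lookup∘updateAt; lookup∘updateAt′; []≔-lookup; insertAt-lookup; removeAt-insertAt)
open import Function using (_∘_)
open import Function.Bundles using (Equivalence; mk⇔)
open import Relation.Binary.Definitions using (DecidableEquality)
open import Relation.Binary.PropositionalEquality hiding ([_])
open import Relation.Nullary using (Dec; yes; no; does; ¬_; ¬?; contradiction)
open import Relation.Nullary.Decidable using (dec-true; dec-false; _×-dec_)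

-- Numerical bounds for weighted sums over permutations.

rising : ℕ → ℕ → ℕ
rising N zero    = 1
rising N (suc r) = (N + r) * rising N r

^≤rising : ∀ N r → N ^ r ≤ rising N r
^≤rising N zero    = ≤-refl
^≤rising N (suc r) = *-mono-≤ (m≤m+n N r) (^≤rising N r)

^-distribʳ-* : ∀ n a b → (a * b) ^ n ≡ a ^ n * b ^ n
^-distribʳ-* zero    a b = refl
^-distribʳ-* (suc n) a b = trans (cong (a * b *_) (^-distribʳ-* n a b)) (lem a b (a ^ n) (b ^ n))
  where
  lem : ∀ a b x y → a * b * (x * y) ≡ a * x * (b * y)
  lem = solve-∀

-- fixedBound a e r is r! [xʳ] (1 − x)⁻⁽ᵃ⁺ᵉ⁾ exp(− e x): the sum over the permutations of r points of the
-- product of weights a for the fixed points and a + e for the longer cycles.  mixedBound a e g b has g + b points,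
-- b of which have weight a + e even when fixed.
module _ (a e : ℕ) where

  -- The recurrence is of second order. Carrying two consecutive values costs one recursive call per
  -- step, which the evaluations for i < 50 rely on.
  fixedBoundStep : ℕ → ℕ × ℕ → ℕ × ℕ
  fixedBoundStep r (x , y) = y , (a + suc r) * y + suc r * (e * x)

  fixedBoundPair : ℕ → ℕ × ℕ
  fixedBoundPair zero    = 1 , a
  fixedBoundPair (suc r) = fixedBoundStep r (fixedBoundPair r)

  fixedBound : ℕ → ℕ
  fixedBound r = proj₁ (fixedBoundPair r)

  mixedBound : ℕ → ℕ → ℕ
  mixedBound g zero    = fixedBound g
  mixedBound g (suc b) = mixedBound (suc g) b + e * mixedBound g b

  -- Removal of one light point: it is fixed with weight a, or spliced in at one of the b heavy
  -- points, which stays heavy, or at one of the g light points, which becomes heavy. At g = 0 the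
  -- factor g kills the term with the truncated `pred g`.
  mixedBound-suc : ∀ g b → mixedBound (suc g) b ≡ (a + b) * mixedBound g b + g * mixedBound (pred g) (suc b)
  mixedBound-suc zero zero = lem a
    where
    lem : ∀ a → a ≡ (a + 0) * 1 + 0
    lem = solve-∀
  mixedBound-suc (suc g) zero = lem a e g (fixedBound (suc g)) (fixedBound g)
    where
    lem : ∀ a e g y x → (a + suc g) * y + suc g * (e * x) ≡ (a + 0) * y + suc g * (y + e * x)
    lem = solve-∀
  mixedBound-suc zero (suc b) = trans (cong₂ _+_ (mixedBound-suc 1 b) (cong (e *_) (mixedBound-suc 0 b))) (lem a b e (mixedBound 1 b) (mixedBound 0 b))
    where
    lem : ∀ a b e y x → (a + b) * y + 1 * (y + e * x) + e * ((a + b) * x + 0) ≡ (a + suc b) * (y + e * x) + 0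
    lem = solve-∀
  mixedBound-suc (suc g) (suc b) =
    trans (cong₂ _+_ (mixedBound-suc (2 + g) b) (cong (e *_) (mixedBound-suc (suc g) b)))
          (lem a b e g (mixedBound (2 + g) b) (mixedBound (suc g) b) (mixedBound g b))
    where
    lem : ∀ a b e g z y x →
      (a + b) * z + suc (suc g) * (z + e * y) + e * ((a + b) * y + suc g * (y + e * x))
      ≡ (a + suc b) * (z + e * y) + suc g * ((z + e * y) + e * (y + e * x))
    lem = solve-∀

  module _ (1≤a : 1 ≤ a) where

    fixedBound-mono : ∀ r → suc r * fixedBound r ≤ fixedBound (suc r)
    fixedBound-mono zero    = ≤-trans 1≤a ≤-refl
    fixedBound-mono (suc r) = ≤-trans (*-monoˡ-≤ (fixedBound (suc r)) (+-monoˡ-≤ (suc r) 1≤a)) (m≤m+n _ _)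

    -- By `fixedBound-mono` the second-order term of the recurrence is at most e times the latest
    -- value, which turns the weight a into a + e.
    fixedBound-growth : ∀ r → fixedBound (suc r) ≤ (a + e + r) * fixedBound r
    fixedBound-growth zero    = ≤-trans (m≤m+n a e) (≤-reflexive (lem a e))
      where
      lem : ∀ a e → a + e ≡ (a + e + 0) * 1
      lem = solve-∀
    fixedBound-growth (suc r) = begin
      (a + suc r) * fixedBound (suc r) + suc r * (e * fixedBound r)   ≡⟨ lem₁ a e r (fixedBound (suc r)) (fixedBound r) ⟩
      (a + suc r) * fixedBound (suc r) + e * (suc r * fixedBound r)   ≤⟨ +-monoʳ-≤ ((a + suc r) * fixedBound (suc r)) (*-monoʳ-≤ e (fixedBound-mono r)) ⟩
      (a + suc r) * fixedBound (suc r) + e * fixedBound (suc r)       ≡⟨ lem₂ a e r (fixedBound (suc r)) ⟩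
      (a + e + suc r) * fixedBound (suc r)                   ∎
      where
      open ≤-Reasoning
      lem₁ : ∀ a e r y x → (a + suc r) * y + suc r * (e * x) ≡ (a + suc r) * y + e * (suc r * x)
      lem₁ = solve-∀
      lem₂ : ∀ a e r y → (a + suc r) * y + e * y ≡ (a + e + suc r) * y
      lem₂ = solve-∀

  -- fixedBound a e r ≤ (ν / D)ʳ as soon as ν / D satisfies the characteristic inequality of the recurrence.
  fixedBound-geometric : ∀ D ν R → a * D ≤ ν →
    (∀ r → r ≤ R → (a + r) * D * ν + r * e * (D * D) ≤ ν * ν) →
    ∀ r → r ≤ R → fixedBound r * D ^ r ≤ ν ^ r × fixedBound (suc r) * D ^ suc r ≤ ν ^ suc r
  fixedBound-geometric D ν R aD≤ν step zero _ = ≤-refl , ≤-trans (≤-reflexive (lem a D)) (≤-trans aD≤ν (≤-reflexive (sym (*-identityʳ ν))))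
    where
    lem : ∀ a D → a * (D * 1) ≡ a * D
    lem = solve-∀
  fixedBound-geometric D ν zero _ _ (suc r) ()
  fixedBound-geometric D ν (suc R) aD≤ν step (suc r) (s≤s r≤R)
    with fixedBound-geometric D ν (suc R) aD≤ν step r (m≤n⇒m≤1+n r≤R)
  ... | p , q = q , (begin
      ((a + suc r) * y + suc r * (e * x)) * (D * (D * D ^ r))
        ≡⟨ lem₁ a e r y x D (D ^ r) ⟩
      (a + suc r) * D * (y * (D * D ^ r)) + suc r * e * (D * D) * (x * D ^ r)
        ≤⟨ +-mono-≤ (*-monoʳ-≤ ((a + suc r) * D) q) (*-monoʳ-≤ (suc r * e * (D * D)) p) ⟩
      (a + suc r) * D * (ν * ν ^ r) + suc r * e * (D * D) * ν ^ r
        ≡⟨ lem₂ a e r D ν (ν ^ r) ⟩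
      ((a + suc r) * D * ν + suc r * e * (D * D)) * ν ^ r
        ≤⟨ *-monoˡ-≤ (ν ^ r) (step (suc r) (s≤s r≤R)) ⟩
      ν * ν * ν ^ r
        ≡⟨ *-assoc ν ν (ν ^ r) ⟩
      ν * (ν * ν ^ r) ∎)
    where
    open ≤-Reasoning
    y = fixedBound (suc r)
    x = fixedBound r
    lem₁ : ∀ a e r y x D P → ((a + suc r) * y + suc r * (e * x)) * (D * (D * P))
      ≡ (a + suc r) * D * (y * (D * P)) + suc r * e * (D * D) * (x * P)
    lem₁ = solve-∀
    lem₂ : ∀ a e r D ν P → (a + suc r) * D * (ν * P) + suc r * e * (D * D) * P
      ≡ ((a + suc r) * D * ν + suc r * e * (D * D)) * P
    lem₂ = solve-∀

-- The sum of g over the permutations of i points, g being evaluated at the number of cycles.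
stirlingSum : ℕ → (ℕ → ℕ) → ℕ
stirlingSum zero    g = g 0
stirlingSum (suc i) g = stirlingSum i (λ z → g (suc z) + i * g z)

combine : ℕ → List ℕ → List ℕ
combine j []           = []
combine j (x ∷ [])     = []
combine j (x ∷ y ∷ ys) = (y + j * x) ∷ combine j (y ∷ ys)

-- A version of stirlingSum that evaluates in polynomial time.
stirlingSumList : ℕ → List ℕ → ℕ
stirlingSumList _       []       = 0
stirlingSumList zero    (x ∷ _)  = x
stirlingSumList (suc i) xs       = stirlingSumList i (combine i xs)

smallCheck : ℕ → Bool
smallCheck i = stirlingSumList i (applyUpTo (λ z → fixedBound (2 ^ z) (2 ^ i ∸ 2 ^ z) (suc i)) (suc i)) ≤ᵇ 2 * rising (2 ^ i) (suc i)

smallChecks : ℕ → Bool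
smallChecks zero    = true
smallChecks (suc i) = smallCheck i ∧ smallChecks i

smallChecks-50 : T (smallChecks 50)
-- All fifty Boolean comparisons are evaluated here by the type checker.
smallChecks-50 = tt

smallChecks⇒ : ∀ k {i} → i < k → T (smallChecks k) → T (smallCheck i)
smallChecks⇒ (suc k) {i} i<1+k t with m<1+n⇒m<n∨m≡n i<1+k | Equivalence.to T-∧ t
... | inj₁ i<k  | _ , u = smallChecks⇒ k i<k u
... | inj₂ refl | u , _ = u

combine-applyUpTo : ∀ j g n → combine j (applyUpTo g (suc n)) ≡ applyUpTo (λ z → g (suc z) + j * g z) n
combine-applyUpTo j g zero    = refl
combine-applyUpTo j g (suc n) = cong (_ ∷_) (combine-applyUpTo j (g ∘ suc) n)

stirlingSumList-applyUpTo : ∀ i g → stirlingSumList i (applyUpTo g (suc i)) ≡ stirlingSum i g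
stirlingSumList-applyUpTo zero    g = refl
stirlingSumList-applyUpTo (suc i) g = trans (cong (stirlingSumList i) (combine-applyUpTo i g (suc i))) (stirlingSumList-applyUpTo i _)

stirlingSum-mono : ∀ i {f g} → (∀ z → z ≤ i → f z ≤ g z) → stirlingSum i f ≤ stirlingSum i g
stirlingSum-mono zero    h = h 0 z≤n
stirlingSum-mono (suc i) h = stirlingSum-mono i λ z z≤i → +-mono-≤ (h (suc z) (s≤s z≤i)) (*-monoʳ-≤ i (h z (m≤n⇒m≤1+n z≤i)))

stirlingSum-* : ∀ i c g → stirlingSum i (λ z → c * g z) ≤ c * stirlingSum i g
stirlingSum-* zero    c g = ≤-refl
stirlingSum-* (suc i) c g = ≤-trans (stirlingSum-mono i λ z _ → ≤-reflexive (lem c i (g (suc z)) (g z))) (stirlingSum-* i c _)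
  where
  lem : ∀ c i y x → c * y + i * (c * x) ≡ c * (y + i * x)
  lem = solve-∀

-- The homogeneous generating polynomial of the Stirling numbers of the first kind: the sum of A^z
-- B^(i - z) over the permutations of i points, z being the number of cycles.
linearProduct : ℕ → ℕ → ℕ → ℕ
linearProduct A B zero    = 1
linearProduct A B (suc i) = (A + i * B) * linearProduct A B i

-- The hypothesis reads g z <= (K / D) (B / A)^m. K and D are general for the sake of the induction:
-- unfolding `stirlingSum` once moves a factor A + i B into K and a factor A into D.
stirlingSum≤linearProduct : ∀ i g A B K D → (∀ z m → z + m ≡ i → g z * A ^ m * D ≤ K * B ^ m) →
  stirlingSum i g * A ^ i * D ≤ K * linearProduct A B i
stirlingSum≤linearProduct zero    g A B K D h = h 0 0 refl
stirlingSum≤linearProduct (suc i) g A B K D h = begin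
  S * (A * A ^ i) * D                   ≡⟨ lem₁ S A (A ^ i) D ⟩
  S * A ^ i * (A * D)                   ≤⟨ stirlingSum≤linearProduct i _ A B (K * (A + i * B)) (A * D) h′ ⟩
  K * (A + i * B) * linearProduct A B i ≡⟨ *-assoc K (A + i * B) _ ⟩
  K * ((A + i * B) * linearProduct A B i) ∎
  where
  open ≤-Reasoning
  S = stirlingSum i (λ z → g (suc z) + i * g z)
  lem₁ : ∀ S A P D → S * (A * P) * D ≡ S * P * (A * D)
  lem₁ = solve-∀
  lem₂ : ∀ y x i P A D → (y + i * x) * P * (A * D) ≡ A * (y * P * D) + i * (x * (A * P) * D)
  lem₂ = solve-∀
  lem₃ : ∀ A B K i P → A * (K * P) + i * (K * (B * P)) ≡ K * (A + i * B) * P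
  lem₃ = solve-∀
  h′ : ∀ z m → z + m ≡ i → (g (suc z) + i * g z) * A ^ m * (A * D) ≤ K * (A + i * B) * B ^ m
  h′ z m eq = begin
    (g (suc z) + i * g z) * A ^ m * (A * D)
      ≡⟨ lem₂ (g (suc z)) (g z) i (A ^ m) A D ⟩
    A * (g (suc z) * A ^ m * D) + i * (g z * A ^ suc m * D)
      ≤⟨ +-mono-≤ (*-monoʳ-≤ A (h (suc z) m (cong suc eq))) (*-monoʳ-≤ i (h z (suc m) (trans (+-suc z m) (cong suc eq)))) ⟩
    A * (K * B ^ m) + i * (K * (B * B ^ m))
      ≡⟨ lem₃ A B K i (B ^ m) ⟩
    K * (A + i * B) * B ^ m ∎

-- With x = B / A this is (1 + k x) (1 + k² x) <= 1 + (k + 1)² x, where k² x <= 1 absorbs the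
-- quadratic term into k x and one further x completes the square.
linearProduct-bound : ∀ A B k → k * k * B ≤ A → A * linearProduct A B k ≤ A ^ k * (A + k * k * B)
linearProduct-bound A B zero    _ = ≤-reflexive (lem A)
  where
  lem : ∀ A → A * 1 ≡ 1 * (A + 0)
  lem = solve-∀
linearProduct-bound A B (suc k) h = begin
  A * ((A + k * B) * linearProduct A B k)      ≡⟨ lem₁ A (A + k * B) (linearProduct A B k) ⟩
  (A + k * B) * (A * linearProduct A B k)      ≤⟨ *-monoʳ-≤ (A + k * B) (linearProduct-bound A B k h′) ⟩
  (A + k * B) * (A ^ k * (A + k * k * B))      ≡⟨ lem₂ A B k (A ^ k) ⟩
  A ^ k * (A * (A + (k * k + k) * B) + k * B * (k * k * B)) ≤⟨ *-monoʳ-≤ (A ^ k) (+-monoʳ-≤ (A * (A + (k * k + k) * B)) (*-monoʳ-≤ (k * B) h′)) ⟩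
  A ^ k * (A * (A + (k * k + k) * B) + k * B * A) ≤⟨ *-monoʳ-≤ (A ^ k) (m≤m+n _ (A * B)) ⟩
  A ^ k * (A * (A + (k * k + k) * B) + k * B * A + A * B) ≡⟨ lem₃ A B k (A ^ k) ⟩
  A * A ^ k * (A + suc k * suc k * B) ∎
  where
  open ≤-Reasoning
  h′ : k * k * B ≤ A
  h′ = ≤-trans (*-monoˡ-≤ B (*-mono-≤ (n≤1+n k) (n≤1+n k))) h
  lem₁ : ∀ A x y → A * (x * y) ≡ x * (A * y)
  lem₁ = solve-∀
  lem₂ : ∀ A B k P → (A + k * B) * (P * (A + k * k * B)) ≡ P * (A * (A + (k * k + k) * B) + k * B * (k * k * B))
  lem₂ = solve-∀
  lem₃ : ∀ A B k P → P * (A * (A + (k * k + k) * B) + k * B * A + A * B) ≡ A * P * (A + suc k * suc k * B)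
  lem₃ = solve-∀

-- The critical case r = i + 1 for i at least 50.

module LargeBase where

  from-50 : ∀ (P : ℕ → Set) → P 50 → (∀ i → 50 ≤ i → P i → P (suc i)) → ∀ i → 50 ≤ i → P i
  from-50 P base step i 50≤i = go (≤⇒≤′ 50≤i)
    where
    go : ∀ {i} → 50 ≤′ i → P i
    go (≤′-reflexive refl) = base
    go (≤′-step 50≤′i)     = step _ (≤′⇒≤ 50≤′i) (go 50≤′i)

  -- This inequality fixes the threshold near 50: it still fails at i = 48.
  6i8^i≤9^i : ∀ i → 50 ≤ i → 6 * i * 8 ^ i ≤ 9 ^ i
  6i8^i≤9^i = from-50 (λ i → 6 * i * 8 ^ i ≤ 9 ^ i) (≤ᵇ⇒≤ _ _ tt) λ i 50≤i ih → begin
    6 * suc i * (8 * 8 ^ i)              ≡⟨ lem₁ i (8 ^ i) ⟩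
    (48 * i + 48) * 8 ^ i                ≤⟨ *-monoˡ-≤ (8 ^ i) (+-monoʳ-≤ (48 * i) (*-monoʳ-≤ 6 (≤-trans (≤ᵇ⇒≤ 8 50 tt) 50≤i))) ⟩
    (48 * i + 6 * i) * 8 ^ i             ≡⟨ lem₂ i (8 ^ i) ⟩
    9 * (6 * i * 8 ^ i)                  ≤⟨ *-monoʳ-≤ 9 ih ⟩
    9 * 9 ^ i                            ∎
    where
    open ≤-Reasoning
    lem₁ : ∀ x P → 6 * suc x * (8 * P) ≡ (48 * x + 48) * P
    lem₁ = solve-∀
    lem₂ : ∀ x P → (48 * x + 6 * x) * P ≡ 9 * (6 * x * P)
    lem₂ = solve-∀

  -- The hypothesis of `linearProduct-bound` for A = 4^(i+1) and B = 3^(i+1).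
  i²3^≤4^ : ∀ i → 50 ≤ i → i * i * 3 ^ suc i ≤ 4 ^ suc i
  i²3^≤4^ = from-50 (λ i → i * i * 3 ^ suc i ≤ 4 ^ suc i) (≤ᵇ⇒≤ _ _ tt) λ i 50≤i ih → begin
    suc i * suc i * (3 * 3 ^ suc i)                ≡⟨ lem₁ i (3 ^ suc i) ⟩
    (3 * (i * i) + (6 * i + 3)) * 3 ^ suc i        ≤⟨ *-monoˡ-≤ (3 ^ suc i) (+-monoʳ-≤ (3 * (i * i)) (+-monoʳ-≤ (6 * i) (≤-trans (≤ᵇ⇒≤ 3 50 tt) 50≤i))) ⟩
    (3 * (i * i) + (6 * i + i)) * 3 ^ suc i        ≡⟨ cong (λ x → (3 * (i * i) + x) * 3 ^ suc i) (lem₂ i) ⟩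
    (3 * (i * i) + 7 * i) * 3 ^ suc i              ≤⟨ *-monoˡ-≤ (3 ^ suc i) (+-monoʳ-≤ (3 * (i * i)) (*-monoˡ-≤ i (≤-trans (≤ᵇ⇒≤ 7 50 tt) 50≤i))) ⟩
    (3 * (i * i) + i * i) * 3 ^ suc i              ≡⟨ lem₃ (i * i) (3 ^ suc i) ⟩
    4 * (i * i * 3 ^ suc i)                        ≤⟨ *-monoʳ-≤ 4 ih ⟩
    4 * 4 ^ suc i                                  ∎
    where
    open ≤-Reasoning
    lem₁ : ∀ x P → suc x * suc x * (3 * P) ≡ (3 * (x * x) + (6 * x + 3)) * P
    lem₁ = solve-∀
    lem₂ : ∀ x → 6 * x + x ≡ 7 * x
    lem₂ = solve-∀
    lem₃ : ∀ x P → (3 * x + x) * P ≡ 4 * (x * P)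
    lem₃ = solve-∀

  -- After multiplication by 8^z the left side is at most 6 i 8^i, hence at most 9^z 9^m, and 9 <=
  -- 16 = 2 * 8 takes care of 9^z.
  6r8^m≤2^z9^m : ∀ i z m r → z + m ≡ i → r ≤ i → 6 * i * 8 ^ i ≤ 9 ^ i → 6 * r * 8 ^ m ≤ 2 ^ z * 9 ^ m
  6r8^m≤2^z9^m i z m r refl r≤i key = *-cancelʳ-≤ _ _ (8 ^ z) {{m^n≢0 8 z}} (begin
    6 * r * 8 ^ m * 8 ^ z        ≤⟨ *-monoˡ-≤ (8 ^ z) (*-monoˡ-≤ (8 ^ m) (*-monoʳ-≤ 6 r≤i)) ⟩
    6 * i * 8 ^ m * 8 ^ z        ≡⟨ trans (*-assoc (6 * i) (8 ^ m) (8 ^ z)) (cong (6 * i *_) (trans (*-comm (8 ^ m) (8 ^ z)) (sym (^-distribˡ-+-* 8 z m)))) ⟩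
    6 * i * 8 ^ i                ≤⟨ key ⟩
    9 ^ (z + m)                  ≡⟨ ^-distribˡ-+-* 9 z m ⟩
    9 ^ z * 9 ^ m                ≤⟨ *-monoˡ-≤ (9 ^ m) (^-monoˡ-≤ z (≤ᵇ⇒≤ 9 16 tt)) ⟩
    16 ^ z * 9 ^ m               ≡⟨ cong (_* 9 ^ m) (^-distribʳ-* z 2 8) ⟩
    2 ^ z * 8 ^ z * 9 ^ m        ≡⟨ lem (2 ^ z) (8 ^ z) (9 ^ m) ⟩
    2 ^ z * 9 ^ m * 8 ^ z        ∎)
    where
    open ≤-Reasoning
    lem : ∀ x y w → x * y * w ≡ x * w * y
    lem = solve-∀

  -- With p = 2ᵐ, q = 3q′ = 3ᵐ and u = 2ᶻ this is the step condition of fixedBound-geometric for ν = u q.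
  quadratic : ∀ u p q′ r e → let q = 3 * q′ in p ≤ 2 * q′ → q ≤ p * p → e ≤ u * p →
    6 * r * (p * p * p) ≤ u * (q * q) → (u + r) * p * (u * q) + r * e * (p * p) ≤ u * q * (u * q)
  quadratic u p q′ r e p≤2q′ q≤pp e≤up key = *-cancelˡ-≤ 3 (begin
    3 * ((u + r) * p * (u * q) + r * e * (p * p))
      ≤⟨ *-monoʳ-≤ 3 (+-monoʳ-≤ ((u + r) * p * (u * q)) (*-monoˡ-≤ (p * p) (*-monoʳ-≤ r e≤up))) ⟩
    3 * ((u + r) * p * (u * q) + r * (u * p) * (p * p))
      ≡⟨ lem₁ u p q r ⟩
    3 * u * u * q * p + 3 * r * u * p * q + 3 * r * u * p * (p * p)
      -- Since p is at most two thirds of q, the leading term takes two thirds of (u q)². The two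
      -- error terms become equal, and `key` fits them into the last third.
      ≤⟨ +-monoˡ-≤ _ (+-mono-≤ (*-monoʳ-≤ (3 * u * u * q) p≤2q′) (*-monoʳ-≤ (3 * r * u * p) q≤pp)) ⟩
    3 * u * u * q * (2 * q′) + 3 * r * u * p * (p * p) + 3 * r * u * p * (p * p)
      ≡⟨ lem₂ u p q′ r ⟩
    2 * (u * q * (u * q)) + u * (6 * r * (p * p * p))
      ≤⟨ +-monoʳ-≤ (2 * (u * q * (u * q))) (*-monoʳ-≤ u key) ⟩
    2 * (u * q * (u * q)) + u * (u * (q * q))
      ≡⟨ lem₃ u q ⟩
    3 * (u * q * (u * q)) ∎)
    where
    open ≤-Reasoning
    q = 3 * q′
    lem₁ : ∀ u p q r → 3 * ((u + r) * p * (u * q) + r * (u * p) * (p * p))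
      ≡ 3 * u * u * q * p + 3 * r * u * p * q + 3 * r * u * p * (p * p)
    lem₁ = solve-∀
    lem₂ : ∀ u p q′ r → 3 * u * u * (3 * q′) * (2 * q′) + 3 * r * u * p * (p * p) + 3 * r * u * p * (p * p)
      ≡ 2 * (u * (3 * q′) * (u * (3 * q′))) + u * (6 * r * (p * p * p))
    lem₂ = solve-∀
    lem₃ : ∀ u q → 2 * (u * q * (u * q)) + u * (u * (q * q)) ≡ 3 * (u * q * (u * q))
    lem₃ = solve-∀

  fixedBound≡rising : ∀ N r → fixedBound N 0 r ≡ rising N r
  fixedBound≡rising N zero          = refl
  fixedBound≡rising N (suc zero)    = lem N
    where
    lem : ∀ N → N ≡ (N + 0) * 1
    lem = solve-∀
  fixedBound≡rising N (suc (suc r)) = trans (lem r ((N + suc r) * fixedBound N 0 (suc r))) (cong ((N + suc r) *_) (fixedBound≡rising N (suc r)))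
    where
    lem : ∀ r x → x + suc r * 0 ≡ x
    lem = solve-∀

  -- `fixedBound-geometric` is applied with ν / D = 2^z (3/2)^m = 2^i (3/4)^m. The power of 2^i that
  -- results is at most the rising factorial.
  fixedBound-bound : ∀ i → 6 * i * 8 ^ i ≤ 9 ^ i → ∀ z m → z + m ≡ i →
    fixedBound (2 ^ z) (2 ^ i ∸ 2 ^ z) (suc i) * (4 ^ suc i) ^ m ≤ rising (2 ^ i) (suc i) * (3 ^ suc i) ^ m
  -- Here z = i, so e = 0 and both sides agree. The estimate of the other case needs m > 0, since p
  -- <= (2/3) q fails for p = q = 1.
  fixedBound-bound i key z zero eq rewrite trans (sym (+-identityʳ z)) eq | n∸n≡0 (2 ^ i) =
    ≤-reflexive (cong (_* 1) (fixedBound≡rising (2 ^ i) (suc i)))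
  fixedBound-bound i key z (suc m′) eq = begin
    fixedBound u e R * (4 ^ R) ^ m       ≡⟨ cong (fixedBound u e R *_) (trans (^-swap 4 R m) (trans (cong (_^ R) (^-distribʳ-* m 2 2)) (^-distribʳ-* R p p))) ⟩
    fixedBound u e R * (p ^ R * p ^ R)   ≡⟨ sym (*-assoc (fixedBound u e R) (p ^ R) (p ^ R)) ⟩
    fixedBound u e R * p ^ R * p ^ R     ≤⟨ *-monoˡ-≤ (p ^ R) (proj₂ (fixedBound-geometric u e p (u * q) i (*-monoʳ-≤ u p≤q) step i ≤-refl)) ⟩
    (u * q) ^ R * p ^ R         ≡⟨ sym (^-distribʳ-* R (u * q) p) ⟩
    (u * q * p) ^ R             ≡⟨ cong (_^ R) (lem u q p) ⟩
    (u * p * q) ^ R             ≡⟨ ^-distribʳ-* R (u * p) q ⟩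
    (u * p) ^ R * q ^ R         ≡⟨ cong₂ _*_ (cong (_^ R) up≡N) (^-swap 3 m R) ⟩
    (2 ^ i) ^ R * (3 ^ R) ^ m   ≤⟨ *-monoˡ-≤ ((3 ^ R) ^ m) (^≤rising (2 ^ i) R) ⟩
    rising (2 ^ i) R * (3 ^ R) ^ m ∎
    where
    open ≤-Reasoning
    m = suc m′
    R = suc i
    u = 2 ^ z
    e = 2 ^ i ∸ 2 ^ z
    p = 2 ^ m
    q = 3 ^ m
    lem : ∀ u q p → u * q * p ≡ u * p * q
    lem = solve-∀
    ^-swap : ∀ b x y → (b ^ x) ^ y ≡ (b ^ y) ^ x
    ^-swap b x y = trans (^-*-assoc b x y) (trans (cong (b ^_) (*-comm x y)) (sym (^-*-assoc b y x)))
    up≡N : u * p ≡ 2 ^ i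
    up≡N = trans (sym (^-distribˡ-+-* 2 z m)) (cong (2 ^_) eq)
    p≤q : p ≤ q
    p≤q = ^-monoˡ-≤ m (n≤1+n 2)
    8^m≡ : 8 ^ m ≡ p * p * p
    8^m≡ = trans (^-distribʳ-* m 4 2) (cong (_* p) (^-distribʳ-* m 2 2))
    step : ∀ r → r ≤ i → (u + r) * p * (u * q) + r * e * (p * p) ≤ u * q * (u * q)
    step r r≤i = quadratic u p (3 ^ m′) r e
      (*-monoʳ-≤ 2 (^-monoˡ-≤ m′ (n≤1+n 2)))
      (≤-trans (^-monoˡ-≤ m (n≤1+n 3)) (≤-reflexive (^-distribʳ-* m 2 2)))
      (≤-trans (m∸n≤m (2 ^ i) (2 ^ z)) (≤-reflexive (sym up≡N)))
      (subst₂ (λ x y → 6 * r * x ≤ u * y) 8^m≡ (^-distribʳ-* m 3 3) (6r8^m≤2^z9^m i z m r eq r≤i key))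

  -- With x = (3/4)^(i+1), the sum is at most the rising factorial times the sum of x^(i - z) over
  -- all permutations. The latter is the product of 1 + k x over k < i, at most 1 + i² x, hence at
  -- most 2.
  base : ∀ i → 50 ≤ i → stirlingSum i (λ z → fixedBound (2 ^ z) (2 ^ i ∸ 2 ^ z) (suc i)) ≤ 2 * rising (2 ^ i) (suc i)
  base i 50≤i = *-cancelʳ-≤ _ _ (A * A ^ i) {{m*n≢0 A (A ^ i) {{A≢0}} {{m^n≢0 A i {{A≢0}}}}}} (begin
    S * (A * A ^ i)               ≡⟨ lem₁ S A (A ^ i) ⟩
    A * (S * A ^ i * 1)           ≤⟨ *-monoʳ-≤ A (stirlingSum≤linearProduct i _ A B K 1 λ z m eq → ≤-trans (≤-reflexive (*-identityʳ _)) (fixedBound-bound i (6i8^i≤9^i i 50≤i) z m eq)) ⟩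
    A * (K * linearProduct A B i) ≡⟨ lem₂ A K (linearProduct A B i) ⟩
    K * (A * linearProduct A B i) ≤⟨ *-monoʳ-≤ K (linearProduct-bound A B i (i²3^≤4^ i 50≤i)) ⟩
    K * (A ^ i * (A + i * i * B)) ≤⟨ *-monoʳ-≤ K (*-monoʳ-≤ (A ^ i) (+-monoʳ-≤ A (i²3^≤4^ i 50≤i))) ⟩
    K * (A ^ i * (A + A))         ≡⟨ lem₃ K A (A ^ i) ⟩
    2 * K * (A * A ^ i)           ∎)
    where
    open ≤-Reasoning
    A = 4 ^ suc i
    B = 3 ^ suc i
    K = rising (2 ^ i) (suc i)
    S = stirlingSum i (λ z → fixedBound (2 ^ z) (2 ^ i ∸ 2 ^ z) (suc i))
    A≢0 : NonZero A
    A≢0 = m^n≢0 4 (suc i)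
    lem₁ : ∀ S A P → S * (A * P) ≡ A * (S * P * 1)
    lem₁ = solve-∀
    lem₂ : ∀ A K P → A * (K * P) ≡ K * (A * P)
    lem₂ = solve-∀
    lem₃ : ∀ K A P → K * (P * (A + A)) ≡ 2 * K * (A * P)
    lem₃ = solve-∀

stirlingSum-fixedBound-base : ∀ i → stirlingSum i (λ z → fixedBound (2 ^ z) (2 ^ i ∸ 2 ^ z) (suc i)) ≤ 2 * rising (2 ^ i) (suc i)
stirlingSum-fixedBound-base i with <-≤-connex i 50
... | inj₁ i<50 = subst (_≤ 2 * rising (2 ^ i) (suc i)) (stirlingSumList-applyUpTo i _) (≤ᵇ⇒≤ _ _ (smallChecks⇒ 50 i<50 smallChecks-50))
... | inj₂ 50≤i = LargeBase.base i 50≤i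

-- Both sides grow with r, the left one by a factor of at most 2ⁱ + r, the right one by exactly that factor;
-- so r = i + 1 is the critical case.
stirlingSum-fixedBound≤2rising : ∀ i r → i < r → stirlingSum i (λ z → fixedBound (2 ^ z) (2 ^ i ∸ 2 ^ z) r) ≤ 2 * rising (2 ^ i) r
stirlingSum-fixedBound≤2rising i (suc r) i<1+r with m<1+n⇒m<n∨m≡n i<1+r
... | inj₂ refl = stirlingSum-fixedBound-base i
... | inj₁ i<r  = begin
  stirlingSum i (λ z → fixedBound′ z (suc r))              ≤⟨ stirlingSum-mono i growth ⟩
  stirlingSum i (λ z → (2 ^ i + r) * fixedBound′ z r)      ≤⟨ stirlingSum-* i (2 ^ i + r) (λ z → fixedBound′ z r) ⟩
  (2 ^ i + r) * stirlingSum i (λ z → fixedBound′ z r)      ≤⟨ *-monoʳ-≤ (2 ^ i + r) (stirlingSum-fixedBound≤2rising i r i<r) ⟩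
  (2 ^ i + r) * (2 * rising (2 ^ i) r)   ≡⟨ lem (2 ^ i + r) (rising (2 ^ i) r) ⟩
  2 * ((2 ^ i + r) * rising (2 ^ i) r)   ∎
  where
  open ≤-Reasoning
  fixedBound′ : ℕ → ℕ → ℕ
  fixedBound′ z = fixedBound (2 ^ z) (2 ^ i ∸ 2 ^ z)
  lem : ∀ x y → x * (2 * y) ≡ 2 * (x * y)
  lem = solve-∀
  growth : ∀ z → z ≤ i → fixedBound′ z (suc r) ≤ (2 ^ i + r) * fixedBound′ z r
  growth z z≤i = subst (λ N → fixedBound′ z (suc r) ≤ (N + r) * fixedBound′ z r) (m+[n∸m]≡n (^-monoʳ-≤ 2 z≤i))
                       (fixedBound-growth (2 ^ z) (2 ^ i ∸ 2 ^ z) (m^n>0 2 z) r)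

-- Finite sums and duplicate-free enumerations.

private variable
  X Y Z : Set

∑ : List X → (X → ℕ) → ℕ
∑ []       f = 0
∑ (x ∷ xs) f = f x + ∑ xs f

∑-cong : ∀ (xs : List X) {f g} → (∀ x → f x ≡ g x) → ∑ xs f ≡ ∑ xs g
∑-cong []       h = refl
∑-cong (x ∷ xs) h = cong₂ _+_ (h x) (∑-cong xs h)

∑-mono : ∀ (xs : List X) {f g} → (∀ x → f x ≤ g x) → ∑ xs f ≤ ∑ xs g
∑-mono []       h = ≤-refl
∑-mono (x ∷ xs) h = +-mono-≤ (h x) (∑-mono xs h)

∑-*ˡ : ∀ (xs : List X) c f → ∑ xs (λ x → c * f x) ≡ c * ∑ xs f
∑-*ˡ []       c f = sym (*-zeroʳ c)
∑-*ˡ (x ∷ xs) c f = trans (cong (c * f x +_) (∑-*ˡ xs c f)) (sym (*-distribˡ-+ c (f x) (∑ xs f)))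

∑-+ : ∀ (xs : List X) f g → ∑ xs (λ x → f x + g x) ≡ ∑ xs f + ∑ xs g
∑-+ []       f g = refl
∑-+ (x ∷ xs) f g = trans (cong (f x + g x +_) (∑-+ xs f g)) (lem (f x) (g x) (∑ xs f) (∑ xs g))
  where
  lem : ∀ a b c d → a + b + (c + d) ≡ a + c + (b + d)
  lem = solve-∀

∑-const : ∀ (xs : List X) c → ∑ xs (λ _ → c) ≡ length xs * c
∑-const []       c = refl
∑-const (x ∷ xs) c = cong (c +_) (∑-const xs c)

∑-++ : ∀ (xs ys : List X) f → ∑ (xs ++ ys) f ≡ ∑ xs f + ∑ ys f
∑-++ []       ys f = refl
∑-++ (x ∷ xs) ys f = trans (cong (f x +_) (∑-++ xs ys f)) (sym (+-assoc (f x) (∑ xs f) (∑ ys f)))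

∑-map : ∀ (k : Y → X) ys f → ∑ (map k ys) f ≡ ∑ ys (f ∘ k)
∑-map k []       f = refl
∑-map k (y ∷ ys) f = cong (f (k y) +_) (∑-map k ys f)

∑-cartesianProductWith : ∀ (k : X → Y → Z) xs ys f →
  ∑ (cartesianProductWith k xs ys) f ≡ ∑ xs (λ x → ∑ ys (λ y → f (k x y)))
∑-cartesianProductWith k []       ys f = refl
∑-cartesianProductWith k (x ∷ xs) ys f =
  trans (∑-++ (map (k x) ys) _ f) (cong₂ _+_ (∑-map (k x) ys f) (∑-cartesianProductWith k xs ys f))

∑-tabulate : ∀ {n} (k : Fin n → X) f → ∑ (tabulateᴸ k) f ≡ ∑ (allFin n) (f ∘ k)
∑-tabulate {n = zero}  k f = refl
∑-tabulate {n = suc n} k f =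
  cong (f (k zero) +_) (trans (∑-tabulate (k ∘ suc) f) (sym (∑-tabulate suc (f ∘ k))))

∑-allFin-suc : ∀ n f → ∑ (allFin (suc n)) f ≡ f zero + ∑ (allFin n) (f ∘ suc)
∑-allFin-suc n f = cong (f zero +_) (∑-tabulate suc f)

length≡∑ : ∀ (xs : List X) → length xs ≡ ∑ xs (λ _ → 1)
length≡∑ xs = sym (trans (∑-const xs 1) (*-identityʳ (length xs)))

length-cartesianProductWith : ∀ (k : X → Y → Z) xs ys → length (cartesianProductWith k xs ys) ≡ length xs * length ys
length-cartesianProductWith k xs ys = begin
  length (cartesianProductWith k xs ys)       ≡⟨ length≡∑ (cartesianProductWith k xs ys) ⟩
  ∑ (cartesianProductWith k xs ys) (λ _ → 1)  ≡⟨ ∑-cartesianProductWith k xs ys _ ⟩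
  ∑ xs (λ _ → ∑ ys (λ _ → 1))                 ≡⟨ ∑-const xs _ ⟩
  length xs * ∑ ys (λ _ → 1)                  ≡⟨ cong (length xs *_) (length≡∑ ys) ⟨
  length xs * length ys                       ∎
  where open ≡-Reasoning

𝟙 : ∀ {P : Set} → Dec P → ℕ
𝟙 P? = if does P? then 1 else 0

𝟙-cong : ∀ {P Q : Set} (P? : Dec P) (Q? : Dec Q) → (P → Q) → (Q → P) → 𝟙 P? ≡ 𝟙 Q?
𝟙-cong (yes p) (yes q) f g = refl
𝟙-cong (yes p) (no ¬q) f g = contradiction (f p) ¬q
𝟙-cong (no ¬p) (yes q) f g = contradiction (g q) ¬p
𝟙-cong (no ¬p) (no ¬q) f g = refl

𝟙-× : ∀ {P Q : Set} (P? : Dec P) (Q? : Dec Q) → 𝟙 (P? ×-dec Q?) ≡ 𝟙 P? * 𝟙 Q?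
𝟙-× (yes p) (yes q) = refl
𝟙-× (yes p) (no ¬q) = refl
𝟙-× (no ¬p) Q?      = refl

length-filter≡∑ : ∀ {P : X → Set} (P? : ∀ x → Dec (P x)) xs → length (filter P? xs) ≡ ∑ xs (𝟙 ∘ P?)
length-filter≡∑ P? []       = refl
length-filter≡∑ P? (x ∷ xs) with P? x
... | yes _ = cong suc (length-filter≡∑ P? xs)
... | no  _ = length-filter≡∑ P? xs

record Finite (X : Set) : Set where
  field
    elems    : List X
    unique   : Unique elems
    complete : ∀ x → x ∈ elems

  card : ℕ
  card = length elems

open Finite

module _ (_≟X_ : DecidableEquality X) where

  ∑-𝟙≡-absent : ∀ {w} {xs} → All (w ≢_) xs → ∑ xs (λ v → 𝟙 (v ≟X w)) ≡ 0
  ∑-𝟙≡-absent []         = refl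
  ∑-𝟙≡-absent {w} {x ∷ _} (w≢x ∷ w∉xs) with x ≟X w
  ... | yes x≡w = contradiction (sym x≡w) w≢x
  ... | no  _   = ∑-𝟙≡-absent w∉xs

  ∑-𝟙≡ : ∀ {w xs} → Unique xs → w ∈ xs → ∑ xs (λ v → 𝟙 (v ≟X w)) ≡ 1
  ∑-𝟙≡ {w} (w∉xs ∷ _) (here refl) with w ≟X w
  ... | yes _  = cong suc (∑-𝟙≡-absent w∉xs)
  ... | no w≢w = contradiction refl w≢w
  ∑-𝟙≡ {w} {x ∷ _} (x∉xs ∷ u) (there w∈xs) with x ≟X w
  ... | no _     = ∑-𝟙≡ u w∈xs
  ... | yes refl = contradiction w∈xs (All¬⇒¬Any x∉xs)

BoolFinite : Finite Bool
BoolFinite .elems    = false ∷ true ∷ []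
BoolFinite .unique   = ((λ ()) ∷ []) ∷ [] ∷ []
BoolFinite .complete false = here refl
BoolFinite .complete true  = there (here refl)

VecFinite : Finite X → ∀ n → Finite (Vec X n)
VecFinite F zero .elems    = [] ∷ []
VecFinite F zero .unique   = [] ∷ []
VecFinite F zero .complete [] = here refl
VecFinite F (suc n) .elems    = cartesianProductWith (λ G v → v ∷ G) (elems (VecFinite F n)) (elems F)
VecFinite F (suc n) .unique   = cartesianProductWith⁺ _ (λ { refl → refl , refl }) (unique (VecFinite F n)) (unique F)
VecFinite F (suc n) .complete (v ∷ G) = ∈-cartesianProductWith⁺ _ (complete (VecFinite F n) G) (complete F v)

card-Vec : ∀ (F : Finite X) n → card (VecFinite F n) ≡ card F ^ n
card-Vec F zero    = refl
card-Vec F (suc n) = begin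
  card (VecFinite F (suc n))      ≡⟨ length-cartesianProductWith _ (elems (VecFinite F n)) (elems F) ⟩
  card (VecFinite F n) * card F   ≡⟨ cong (_* card F) (card-Vec F n) ⟩
  card F ^ n * card F             ≡⟨ *-comm (card F ^ n) (card F) ⟩
  card F * card F ^ n             ∎
  where open ≡-Reasoning

-- Enumeration of permutations.

-- j ▹ c is the permutation obtained by swapping 0 and j first and then applying c to the points other than 0;
-- thus 0 is a fixed point if j = 0, and otherwise it is spliced into the cycle of c through j.
data Code : ℕ → Set where
  ε   : Code 0
  _▹_ : ∀ {n} → Fin (suc n) → Code n → Code (suc n)

⟦_⟧ : ∀ {n} → Code n → Permutation′ n
⟦ ε ⟧     = idₚ
⟦ j ▹ c ⟧ = transpose zero j ∘ₚ lift₀ ⟦ c ⟧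

CodeFinite : ∀ n → Finite (Code n)
CodeFinite zero .elems    = ε ∷ []
CodeFinite zero .unique   = [] ∷ []
CodeFinite zero .complete ε = here refl
CodeFinite (suc n) .elems    = cartesianProductWith _▹_ (allFin (suc n)) (elems (CodeFinite n))
CodeFinite (suc n) .unique   = cartesianProductWith⁺ _ (λ { refl → refl , refl }) (allFin⁺ (suc n)) (unique (CodeFinite n))
CodeFinite (suc n) .complete (j ▹ c) = ∈-cartesianProductWith⁺ _ (∈-allFin j) (complete (CodeFinite n) c)

codes : ∀ n → List (Code n)
codes n = elems (CodeFinite n)

∑-codes-suc : ∀ n f → ∑ (codes (suc n)) f ≡
  ∑ (codes n) (λ c → f (zero ▹ c)) + ∑ (allFin n) (λ j → ∑ (codes n) (λ c → f (suc j ▹ c)))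
∑-codes-suc n f = trans (∑-cartesianProductWith _▹_ (allFin (suc n)) (codes n) f) (∑-allFin-suc n _)

length-allFin : ∀ n → length (allFin n) ≡ n
length-allFin n = length-tabulate {n = n} (λ i → i)

length-codes : ∀ n → length (codes n) ≡ n !
length-codes zero    = refl
length-codes (suc n) = trans (length-cartesianProductWith _▹_ (allFin (suc n)) (codes n))
  (cong₂ _*_ (length-allFin (suc n)) (length-codes n))

transpose-involutive : ∀ {n} (j y : Fin (suc n)) → transpose zero j ⟨$⟩ʳ (transpose zero j ⟨$⟩ʳ y) ≡ y
transpose-involutive zero    zero    = refl
transpose-involutive (suc j) zero rewrite dec-true (j ≟ j) refl = refl
transpose-involutive zero    (suc y) = refl
transpose-involutive (suc j) (suc y) with y ≟ j
... | yes refl = refl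
... | no  y≢j rewrite dec-false (y ≟ j) y≢j = refl

-- For j = π⁻¹(0), swapping 0 and j before π gives a permutation that fixes 0; its restriction to
-- the other points is coded recursively.
⟦⟧-surjective : ∀ {n} (π : Permutation′ n) → ∃ λ c → ⟦ c ⟧ ≈ₚ π
⟦⟧-surjective {zero}  π = ε , λ ()
⟦⟧-surjective {suc n} π with ⟦⟧-surjective (remove zero (transpose zero (π ⟨$⟩ˡ zero) ∘ₚ π))
... | c , ⟦c⟧≈ = j ▹ c , λ y → begin
  lift₀ ⟦ c ⟧ ⟨$⟩ʳ (τ ⟨$⟩ʳ y)             ≡⟨ lift₀-cong ⟦ c ⟧ (remove zero ρ) ⟦c⟧≈ (τ ⟨$⟩ʳ y) ⟩
  lift₀ (remove zero ρ) ⟨$⟩ʳ (τ ⟨$⟩ʳ y)   ≡⟨ lift₀-remove ρ (inverseʳ π) (τ ⟨$⟩ʳ y) ⟩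
  ρ ⟨$⟩ʳ (τ ⟨$⟩ʳ y)                       ≡⟨ cong (π ⟨$⟩ʳ_) (transpose-involutive j y) ⟩
  π ⟨$⟩ʳ y                                ∎
  where
  open ≡-Reasoning
  j = π ⟨$⟩ˡ zero
  τ = transpose zero j
  ρ = τ ∘ₚ π

-- Unfolding encode during conversion checking is prohibitively slow.
abstract
  encode : ∀ {n} → Permutation′ n → Code n
  encode π = proj₁ (⟦⟧-surjective π)

  ⟦encode⟧ : ∀ {n} (π : Permutation′ n) → ⟦ encode π ⟧ ≈ₚ π
  ⟦encode⟧ π = proj₂ (⟦⟧-surjective π)

⟦▹⟧-preimage : ∀ {n} i (c : Code n) → ⟦ i ▹ c ⟧ ⟨$⟩ˡ zero ≡ i
⟦▹⟧-preimage zero    c = refl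
⟦▹⟧-preimage (suc i) c = refl

-- The preimage of 0 recovers the leading entry. The equal swaps then cancel, leaving the two tails.
⟦⟧-injective : ∀ {n} (c d : Code n) → ⟦ c ⟧ ≈ₚ ⟦ d ⟧ → c ≡ d
⟦⟧-injective ε ε _ = refl
⟦⟧-injective (i ▹ c) (j ▹ d) h = aux i≡j h
  where
  open ≡-Reasoning
  i≡j : i ≡ j
  i≡j = begin
    i                                        ≡⟨ inverseˡ ⟦ j ▹ d ⟧ ⟨
    ⟦ j ▹ d ⟧ ⟨$⟩ˡ (⟦ j ▹ d ⟧ ⟨$⟩ʳ i)        ≡⟨ cong (⟦ j ▹ d ⟧ ⟨$⟩ˡ_) (h i) ⟨
    ⟦ j ▹ d ⟧ ⟨$⟩ˡ (⟦ i ▹ c ⟧ ⟨$⟩ʳ i)        ≡⟨ cong (λ k → ⟦ j ▹ d ⟧ ⟨$⟩ˡ (⟦ i ▹ c ⟧ ⟨$⟩ʳ k)) (⟦▹⟧-preimage i c) ⟨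
    ⟦ j ▹ d ⟧ ⟨$⟩ˡ (⟦ i ▹ c ⟧ ⟨$⟩ʳ (⟦ i ▹ c ⟧ ⟨$⟩ˡ zero)) ≡⟨ cong (⟦ j ▹ d ⟧ ⟨$⟩ˡ_) (inverseʳ ⟦ i ▹ c ⟧ {zero}) ⟩
    ⟦ j ▹ d ⟧ ⟨$⟩ˡ zero                      ≡⟨ ⟦▹⟧-preimage j d ⟩
    j                                        ∎
  aux : ∀ {i j} → i ≡ j → ⟦ i ▹ c ⟧ ≈ₚ ⟦ j ▹ d ⟧ → i ▹ c ≡ j ▹ d
  aux {i} refl h = cong (i ▹_) (⟦⟧-injective c d λ y → suc-injective
    (subst (λ u → lift₀ ⟦ c ⟧ ⟨$⟩ʳ u ≡ lift₀ ⟦ d ⟧ ⟨$⟩ʳ u)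
      (transpose-involutive i (suc y)) (h (transpose zero i ⟨$⟩ʳ suc y))))

-- The number of cycles of `⟦ c ⟧`: an entry zero opens a cycle, any other entry lengthens an
-- existing one.
zeros : ∀ {r} → Code r → ℕ
zeros ε           = 0
zeros (zero ▹ c)  = suc (zeros c)
zeros (suc _ ▹ c) = zeros c

trues falses : ∀ {r} → Vec Bool r → ℕ
trues []          = 0
trues (true ∷ τ)  = suc (trues τ)
trues (false ∷ τ) = trues τ
falses []          = 0
falses (true ∷ τ)  = falses τ
falses (false ∷ τ) = suc (falses τ)

trues-[]≔ : ∀ {r} (τ : Vec Bool r) j → lookup τ j ≡ true → trues (τ [ j ]≔ false) ≡ pred (trues τ)
trues-[]≔ (true ∷ τ)  zero    p = refl
trues-[]≔ (true ∷ τ)  (suc j) p = trans (cong suc (trues-[]≔ τ j p)) (suc-pred (trues τ) {{trues≢0 τ j p}})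
  where
  trues≢0 : ∀ {r} (τ : Vec Bool r) j → lookup τ j ≡ true → NonZero (trues τ)
  trues≢0 (true ∷ τ)  j       p = _
  trues≢0 (false ∷ τ) (suc j) p = trues≢0 τ j p
trues-[]≔ (false ∷ τ) (suc j) p = trues-[]≔ τ j p

falses-[]≔ : ∀ {r} (τ : Vec Bool r) j → lookup τ j ≡ true → falses (τ [ j ]≔ false) ≡ suc (falses τ)
falses-[]≔ (true ∷ τ)  zero    p = refl
falses-[]≔ (true ∷ τ)  (suc j) p = falses-[]≔ τ j p
falses-[]≔ (false ∷ τ) (suc j) p = cong suc (falses-[]≔ τ j p)

∑-if-lookup : ∀ {r} (τ : Vec Bool r) x y →
  ∑ (allFin r) (λ j → if lookup τ j then x else y) ≡ trues τ * x + falses τ * y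
∑-if-lookup []          x y = refl
∑-if-lookup {suc r} (true ∷ τ)  x y = trans (∑-allFin-suc r _) (trans (cong (x +_) (∑-if-lookup τ x y)) (sym (+-assoc x _ _)))
∑-if-lookup {suc r} (false ∷ τ) x y = trans (∑-allFin-suc r _) (trans (cong (y +_) (∑-if-lookup τ x y)) (lem x y (trues τ) (falses τ)))
  where
  lem : ∀ x y g f → y + (g * x + f * y) ≡ g * x + suc f * y
  lem = solve-∀

-- Vectors fixed by a permutation up to a twist.

-- For a family t of self-maps of X, one for each of r points, the pairs (c , G) with G y = t y (G (c y)) for all y
-- are counted by removing point 0: if c fixes 0, then G 0 is a fixed point of t 0; otherwise G 0 is determined
-- by the rest of G, and the map at the point j with c j = 0 becomes t j ∘ t 0.
module Twisted (F : Finite X) (_≟X_ : DecidableEquality X) where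

  fixes : (X → X) → ℕ
  fixes s = ∑ (elems F) (λ v → 𝟙 (v ≟X s v))

  fixes≤card : ∀ s → fixes s ≤ card F
  fixes≤card s = ≤-trans (∑-mono (elems F) (λ v → 𝟙≤1 (v ≟X s v))) (≤-reflexive (sym (length≡∑ (elems F))))
    where
    𝟙≤1 : ∀ {P : Set} (P? : Dec P) → 𝟙 P? ≤ 1
    𝟙≤1 (yes _) = ≤-refl
    𝟙≤1 (no _)  = z≤n

  fixes-id : ∀ {s} → (∀ v → s v ≡ v) → fixes s ≡ card F
  fixes-id {s} h = trans (∑-cong (elems F) λ v → cong (if_then 1 else 0) (dec-true (v ≟X s v) (sym (h v)))) (sym (length≡∑ (elems F)))

  Fixed : ∀ {r} → Code r → (Fin r → X → X) → Vec X r → Set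
  Fixed c t G = ∀ y → lookup G y ≡ t y (lookup G (⟦ c ⟧ ⟨$⟩ʳ y))

  Fixed? : ∀ {r} (c : Code r) t G → Dec (Fixed c t G)
  Fixed? c t G = all? λ y → lookup G y ≟X t y (lookup G (⟦ c ⟧ ⟨$⟩ʳ y))

  vecs : ∀ r → List (Vec X r)
  vecs r = elems (VecFinite F r)

  #Fixed : ∀ {r} → Code r → (Fin r → X → X) → ℕ
  #Fixed {r} c t = ∑ (vecs r) (𝟙 ∘ Fixed? c t)

  merge : ∀ {r} → (Fin (suc r) → X → X) → Fin r → Fin r → X → X
  merge t j y = if does (y ≟ j) then t (suc j) ∘ t zero else t (suc y)

  #Fixed-zero : ∀ {r} (c : Code r) t → #Fixed (zero ▹ c) t ≡ fixes (t zero) * #Fixed c (t ∘ suc)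
  #Fixed-zero {r} c t = begin
    #Fixed (zero ▹ c) t
      ≡⟨ ∑-cartesianProductWith _ (vecs r) (elems F) _ ⟩
    ∑ (vecs r) (λ G → ∑ (elems F) (λ v → 𝟙 (Fixed? (zero ▹ c) t (v ∷ G))))
      ≡⟨ ∑-cong (vecs r) (λ G → trans (∑-cong (elems F) (λ v → split G v))
           (trans (∑-*ˡ (elems F) (𝟙 (Fixed? c (t ∘ suc) G)) _) (*-comm (𝟙 (Fixed? c (t ∘ suc) G)) _))) ⟩
    ∑ (vecs r) (λ G → fixes (t zero) * 𝟙 (Fixed? c (t ∘ suc) G))
      ≡⟨ ∑-*ˡ (vecs r) (fixes (t zero)) _ ⟩
    fixes (t zero) * #Fixed c (t ∘ suc) ∎
    where
    open ≡-Reasoning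
    split : ∀ G v → 𝟙 (Fixed? (zero ▹ c) t (v ∷ G)) ≡ 𝟙 (Fixed? c (t ∘ suc) G) * 𝟙 (v ≟X t zero v)
    split G v = trans
      (𝟙-cong (Fixed? (zero ▹ c) t (v ∷ G)) (Fixed? c (t ∘ suc) G ×-dec v ≟X t zero v)
        (λ h → h ∘ suc , h zero) (λ { (h , k) zero → k ; (h , k) (suc y) → h y }))
      (𝟙-× (Fixed? c (t ∘ suc) G) (v ≟X t zero v))

  #Fixed-suc : ∀ {r} j (c : Code r) t → #Fixed (suc j ▹ c) t ≡ #Fixed c (merge t j)
  #Fixed-suc {r} j c t = begin
    #Fixed (suc j ▹ c) t
      ≡⟨ ∑-cartesianProductWith _ (vecs r) (elems F) _ ⟩
    ∑ (vecs r) (λ G → ∑ (elems F) (λ v → 𝟙 (Fixed? (suc j ▹ c) t (v ∷ G))))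
      ≡⟨ ∑-cong (vecs r) (λ G → trans (∑-cong (elems F) (λ v → split G v))
           (trans (∑-*ˡ (elems F) (𝟙 (Fixed? c (merge t j) G)) _)
           (trans (cong (𝟙 (Fixed? c (merge t j) G) *_) (∑-𝟙≡ _≟X_ (unique F) (complete F _))) (*-identityʳ _)))) ⟩
    #Fixed c (merge t j) ∎
    where
    open ≡-Reasoning
    module _ (G : Vec X r) (v : X) where
      w = t zero (lookup G (⟦ c ⟧ ⟨$⟩ʳ j))
      to : Fixed (suc j ▹ c) t (v ∷ G) → Fixed c (merge t j) G × v ≡ w
      to h = go , h zero
        where
        go : Fixed c (merge t j) G
        go y with y ≟ j | h (suc y)
        ... | yes refl | eq = trans eq (cong (t (suc j)) (h zero))
        ... | no _     | eq = eq
      from : Fixed c (merge t j) G × v ≡ w → Fixed (suc j ▹ c) t (v ∷ G)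
      from (h , eq) zero = eq
      from (h , eq) (suc y) with y ≟ j | h y
      ... | yes refl | eq′ = trans eq′ (cong (t (suc j)) (sym eq))
      ... | no _     | eq′ = eq′
      split : 𝟙 (Fixed? (suc j ▹ c) t (v ∷ G)) ≡ 𝟙 (Fixed? c (merge t j) G) * 𝟙 (v ≟X w)
      split = trans (𝟙-cong (Fixed? (suc j ▹ c) t (v ∷ G)) (Fixed? c (merge t j) G ×-dec v ≟X w) to from)
                    (𝟙-× (Fixed? c (merge t j) G) (v ≟X w))

  #FixedPairs : ∀ {r} → (Fin r → X → X) → ℕ
  #FixedPairs {r} t = ∑ (codes r) (λ c → #Fixed c t)

  #FixedPairs-suc : ∀ {r} (t : Fin (suc r) → X → X) →
    #FixedPairs t ≡ fixes (t zero) * #FixedPairs (t ∘ suc) + ∑ (allFin r) (λ j → #FixedPairs (merge t j))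
  #FixedPairs-suc {r} t = trans (∑-codes-suc r _) (cong₂ _+_
    (trans (∑-cong (codes r) (λ c → #Fixed-zero c t)) (∑-*ˡ (codes r) (fixes (t zero)) _))
    (∑-cong (allFin r) (λ j → ∑-cong (codes r) (λ c → #Fixed-suc j c t))))

  merge-id : ∀ {r} {t : Fin (suc r) → X → X} → (∀ y v → t y v ≡ v) → ∀ j y v → merge t j y v ≡ v
  merge-id h j y v with does (y ≟ j)
  ... | true  = trans (h (suc j) _) (h zero v)
  ... | false = h (suc y) v

  -- Merging identities yields identities, so each of the r ways to splice in point 0 contributes
  -- the same count, and fixing it contributes `card F` times that count.
  #FixedPairs-id : ∀ {r} (t : Fin r → X → X) → (∀ y v → t y v ≡ v) → #FixedPairs t ≡ rising (card F) r
  #FixedPairs-id {zero}  t h = refl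
  #FixedPairs-id {suc r} t h = begin
    #FixedPairs t
      ≡⟨ #FixedPairs-suc t ⟩
    fixes (t zero) * #FixedPairs (t ∘ suc) + ∑ (allFin r) (λ j → #FixedPairs (merge t j))
      ≡⟨ cong₂ _+_ (cong₂ _*_ (fixes-id (h zero)) (#FixedPairs-id (t ∘ suc) (h ∘ suc)))
           (trans (∑-cong (allFin r) (λ j → #FixedPairs-id (merge t j) (merge-id h j))) (∑-const (allFin r) _)) ⟩
    card F * rising (card F) r + length (allFin r) * rising (card F) r
      ≡⟨ cong (λ k → card F * rising (card F) r + k * rising (card F) r) (length-allFin r) ⟩
    card F * rising (card F) r + r * rising (card F) r
      ≡⟨ *-distribʳ-+ (rising (card F) r) (card F) r ⟨
    (card F + r) * rising (card F) r ∎
    where open ≡-Reasoning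

  -- Such a vector is constant on every cycle of c and arbitrary otherwise.
  #Fixed-id : ∀ {r} (c : Code r) t → (∀ y v → t y v ≡ v) → #Fixed c t ≡ card F ^ zeros c
  #Fixed-id ε           t h = refl
  #Fixed-id (zero ▹ c)  t h = trans (#Fixed-zero c t) (cong₂ _*_ (fixes-id (h zero)) (#Fixed-id c (t ∘ suc) (h ∘ suc)))
  #Fixed-id (suc j ▹ c) t h = trans (#Fixed-suc j c t) (#Fixed-id c (merge t j) (merge-id h j))

  module _ (a e : ℕ) (card≤a+e : card F ≤ a + e) where

    -- τ marks the points whose map is known to have at most a fixed points; merging destroys this knowledge.
    #FixedPairs≤mixedBound : ∀ {r} (τ : Vec Bool r) t → (∀ y → lookup τ y ≡ true → fixes (t y) ≤ a) →
      #FixedPairs t ≤ mixedBound a e (trues τ) (falses τ)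
    #FixedPairs≤mixedBound []      t h = ≤-refl
    #FixedPairs≤mixedBound {suc r} (b ∷ τ) t h = begin
      #FixedPairs t
        ≡⟨ #FixedPairs-suc t ⟩
      fixes (t zero) * #FixedPairs (t ∘ suc) + ∑ (allFin r) (λ j → #FixedPairs (merge t j))
        ≤⟨ +-mono-≤ (*-monoʳ-≤ (fixes (t zero)) (#FixedPairs≤mixedBound τ (t ∘ suc) (h ∘ suc))) (∑-mono (allFin r) merged) ⟩
      fixes (t zero) * B + ∑ (allFin r) (λ j → if lookup τ j then B′ else B)
        ≡⟨ cong (fixes (t zero) * B +_) (∑-if-lookup τ B′ B) ⟩
      fixes (t zero) * B + (trues τ * B′ + falses τ * B)
        ≤⟨ last b (h zero) ⟩
      mixedBound a e (trues (b ∷ τ)) (falses (b ∷ τ)) ∎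
      where
      open ≤-Reasoning
      B  = mixedBound a e (trues τ) (falses τ)
      B′ = mixedBound a e (pred (trues τ)) (suc (falses τ))
      merged : ∀ j → #FixedPairs (merge t j) ≤ (if lookup τ j then B′ else B)
      merged j = ≤-trans (#FixedPairs≤mixedBound (τ [ j ]≔ false) (merge t j) h′) (≤-reflexive (eq (lookup τ j) refl))
        where
        h′ : ∀ y → lookup (τ [ j ]≔ false) y ≡ true → fixes (merge t j y) ≤ a
        h′ y p with y ≟ j
        ... | yes refl = contradiction (trans (sym p) (lookup∘updateAt y τ)) λ ()
        ... | no  y≢j  = h (suc y) (trans (sym (lookup∘updateAt′ y j y≢j τ)) p)
        eq : ∀ b → lookup τ j ≡ b → mixedBound a e (trues (τ [ j ]≔ false)) (falses (τ [ j ]≔ false)) ≡ (if b then B′ else B)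
        eq true  p = cong₂ (mixedBound a e) (trues-[]≔ τ j p) (falses-[]≔ τ j p)
        eq false p = cong (λ τ′ → mixedBound a e (trues τ′) (falses τ′)) (trans (cong (τ [ j ]≔_) (sym p)) ([]≔-lookup τ j))
      rearrange : ∀ a f B B′ g → a * B + (g * B′ + f * B) ≡ (a + f) * B + g * B′
      rearrange = solve-∀
      last : ∀ b → (b ≡ true → fixes (t zero) ≤ a) →
        fixes (t zero) * B + (trues τ * B′ + falses τ * B) ≤ mixedBound a e (trues (b ∷ τ)) (falses (b ∷ τ))
      last true  f = ≤-trans (+-monoˡ-≤ _ (*-monoˡ-≤ B (f refl)))
        (≤-reflexive (trans (rearrange a (falses τ) B B′ (trues τ)) (sym (mixedBound-suc a e (trues τ) (falses τ)))))
      -- An unmarked point 0 weighs up to a + e when fixed; the excess `e * B` is the second summand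
      -- in the recursion of `mixedBound`.
      last false f = ≤-trans (+-monoˡ-≤ _ (*-monoˡ-≤ B (≤-trans (fixes≤card (t zero)) card≤a+e)))
        (≤-reflexive (trans (lem a e (falses τ) B B′ (trues τ)) (cong (_+ e * B) (sym (mixedBound-suc a e (trues τ) (falses τ))))))
        where
        lem : ∀ a e f B B′ g → (a + e) * B + (g * B′ + f * B) ≡ (a + f) * B + g * B′ + e * B
        lem = solve-∀

-- A leading zero adds a cycle and each of the i other entries adds none, as in the recursion of
-- `stirlingSum`.
∑-codes-zeros : ∀ i g → ∑ (codes i) (g ∘ zeros) ≡ stirlingSum i g
∑-codes-zeros zero    g = +-identityʳ (g 0)
∑-codes-zeros (suc i) g = begin
  ∑ (codes (suc i)) (g ∘ zeros)
    ≡⟨ ∑-codes-suc i _ ⟩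
  ∑ (codes i) (g ∘ suc ∘ zeros) + ∑ (allFin i) (λ _ → ∑ (codes i) (g ∘ zeros))
    ≡⟨ cong (∑ (codes i) (g ∘ suc ∘ zeros) +_) (trans (∑-const (allFin i) _) (cong (_* ∑ (codes i) (g ∘ zeros)) (length-allFin i))) ⟩
  ∑ (codes i) (g ∘ suc ∘ zeros) + i * ∑ (codes i) (g ∘ zeros)
    ≡⟨ cong (∑ (codes i) (g ∘ suc ∘ zeros) +_) (∑-*ˡ (codes i) i _) ⟨
  ∑ (codes i) (g ∘ suc ∘ zeros) + ∑ (codes i) (λ c → i * g (zeros c))
    ≡⟨ ∑-+ (codes i) _ _ ⟨
  ∑ (codes i) (λ c → g (suc (zeros c)) + i * g (zeros c))
    ≡⟨ ∑-codes-zeros i (λ z → g (suc z) + i * g z) ⟩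
  stirlingSum (suc i) g ∎
  where open ≡-Reasoning

-- Counting by injections.

∈-++-remove : ∀ {v w : X} as {bs} → w ∈ as ++ v ∷ bs → w ≢ v → w ∈ as ++ bs
∈-++-remove []       (here w≡v)   w≢v = contradiction w≡v w≢v
∈-++-remove []       (there w∈bs) w≢v = w∈bs
∈-++-remove (a ∷ as) (here w≡a)   w≢v = here w≡a
∈-++-remove (a ∷ as) (there w∈)   w≢v = there (∈-++-remove as w∈ w≢v)

-- The image of the head is cut out of `ys`; by injectivity the tail still maps into the rest.
length-injection : ∀ {xs : List X} {ys : List Y} (f : X → Y) → Unique xs →
  (∀ {x} → x ∈ xs → f x ∈ ys) → (∀ {x x′} → x ∈ xs → x′ ∈ xs → f x ≡ f x′ → x ≡ x′) →
  length xs ≤ length ys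
length-injection {xs = []}     f _ _ _ = z≤n
length-injection {xs = x ∷ xs} f (x∉xs ∷ u) f∈ inj with as , bs , refl ← ∈-∃++ (f∈ (here refl)) =
  ≤-trans (s≤s (length-injection f u
            (λ x′∈ → ∈-++-remove as (f∈ (there x′∈)) λ eq → lookupᴬ x∉xs x′∈ (inj (here refl) (there x′∈) (sym eq)))
            (λ p q → inj (there p) (there q))))
          (≤-reflexive (sym (length-++-sucʳ as (f x) bs)))

length-filter-split : ∀ {P : X → Set} (P? : ∀ x → Dec (P x)) xs →
  length (filter P? xs) + length (filter (¬? ∘ P?) xs) ≡ length xs
length-filter-split P? []       = refl
length-filter-split P? (x ∷ xs) with P? x
... | yes _ = cong suc (length-filter-split P? xs)
... | no  _ = trans (+-suc _ _) (cong suc (length-filter-split P? xs))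

-- Matrices and the number of fixed triples.

-- A graph is stored by columns: entry M y x tells whether x ∈ I and y ∈ O are adjacent.
Mat : ℕ → ℕ → Set
Mat i r = Vec (Vec Bool i) r

entry : ∀ {i r} → Mat i r → Fin r → Fin i → Bool
entry M y x = lookup (lookup M y) x

ColFinite : ∀ i → Finite (Vec Bool i)
ColFinite = VecFinite BoolFinite

MatFinite : ∀ i r → Finite (Mat i r)
MatFinite i = VecFinite (ColFinite i)

_≟ᶜ_ : ∀ {i} → DecidableEquality (Vec Bool i)
_≟ᶜ_ = ≡-dec _≟ᵇ_

lookup-ext : ∀ {n} (u v : Vec X n) → (∀ y → lookup u y ≡ lookup v y) → u ≡ v
lookup-ext u v h = trans (sym (tabulate∘lookup u)) (trans (tabulate-cong h) (tabulate∘lookup v))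

permute : ∀ {i} → Code i → Vec Bool i → Vec Bool i
permute σ v = tabulate λ x → lookup v (⟦ σ ⟧ ⟨$⟩ʳ x)

module TwistedBool = Twisted BoolFinite _≟ᵇ_
module TwistedCol (i : ℕ) = Twisted (ColFinite i) _≟ᶜ_

-- A column fixed by σ is a Boolean vector fixed by σ, so the count for `Twisted` applies a second
-- time, over `Bool` with identity maps.
fixes-permute : ∀ {i} (σ : Code i) → TwistedCol.fixes i (permute σ) ≡ 2 ^ zeros σ
fixes-permute {i} σ = trans
  (∑-cong (elems (ColFinite i)) λ v → 𝟙-cong (v ≟ᶜ permute σ v) (TwistedBool.Fixed? σ (λ _ b → b) v)
    (λ eq x → trans (cong (λ u → lookup u x) eq) (lookup∘tabulate _ x))
    (λ h → lookup-ext v _ λ x → trans (h x) (sym (lookup∘tabulate _ x))))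
  (TwistedBool.#Fixed-id σ (λ _ b → b) (λ _ _ → refl))

Triple : ℕ → ℕ → Set
Triple i r = Code i × Code r × Mat i r

-- Entrywise this is `Carries ⟦ σ ⟧ ⟦ c ⟧ M M`; the columnwise form is the one that `Twisted`
-- counts.
FixedTriple : ∀ {i r} → Triple i r → Set
FixedTriple {i} (σ , c , M) = TwistedCol.Fixed i c (λ _ → permute σ) M

FixedTriple? : ∀ {i r} (T : Triple i r) → Dec (FixedTriple T)
FixedTriple? {i} (σ , c , M) = TwistedCol.Fixed? i c (λ _ → permute σ) M

fixedTriples : ∀ i r → List (Triple i r)
fixedTriples i r = filter FixedTriple? (cartesianProduct (codes i) (cartesianProduct (codes r) (elems (MatFinite i r))))

∈-fixedTriples : ∀ {i r} {T : Triple i r} → FixedTriple T → T ∈ fixedTriples i r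
∈-fixedTriples {i} {r} {σ , c , M} = ∈-filter⁺ FixedTriple?
  (∈-cartesianProduct⁺ (complete (CodeFinite i) σ) (∈-cartesianProduct⁺ (complete (CodeFinite r) c) (complete (MatFinite i r) M)))

trues-replicate : ∀ r → trues (replicate r true) ≡ r
trues-replicate zero    = refl
trues-replicate (suc r) = cong suc (trues-replicate r)

falses-replicate : ∀ r → falses (replicate r true) ≡ 0
falses-replicate zero    = refl
falses-replicate (suc r) = falses-replicate r

length-fixedTriples : ∀ i r → i < r → length (fixedTriples i r) ≤ 2 * rising (2 ^ i) r
length-fixedTriples i r i<r = begin
  length (fixedTriples i r)
    ≡⟨ length-filter≡∑ FixedTriple? (cartesianProduct (codes i) pairs) ⟩
  ∑ (cartesianProduct (codes i) pairs) (𝟙 ∘ FixedTriple?)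
    ≡⟨ trans (∑-cartesianProductWith _,_ (codes i) pairs _)
             (∑-cong (codes i) λ σ → ∑-cartesianProductWith _,_ (codes r) (elems (MatFinite i r)) _) ⟩
  ∑ (codes i) (λ σ → TwistedCol.#FixedPairs i {r} (λ _ → permute σ))
    ≤⟨ ∑-mono (codes i) each ⟩
  ∑ (codes i) (λ σ → fixedBound (2 ^ zeros σ) (2 ^ i ∸ 2 ^ zeros σ) r)
    ≡⟨ ∑-codes-zeros i (λ z → fixedBound (2 ^ z) (2 ^ i ∸ 2 ^ z) r) ⟩
  stirlingSum i (λ z → fixedBound (2 ^ z) (2 ^ i ∸ 2 ^ z) r)
    ≤⟨ stirlingSum-fixedBound≤2rising i r i<r ⟩
  2 * rising (2 ^ i) r ∎
  where
  open ≤-Reasoning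
  pairs = cartesianProduct (codes r) (elems (MatFinite i r))
  each : ∀ σ → TwistedCol.#FixedPairs i {r} (λ _ → permute σ) ≤ fixedBound (2 ^ zeros σ) (2 ^ i ∸ 2 ^ zeros σ) r
  each σ = subst₂ (λ g b → TwistedCol.#FixedPairs i {r} (λ _ → permute σ) ≤ mixedBound (2 ^ zeros σ) (2 ^ i ∸ 2 ^ zeros σ) g b)
    (trues-replicate r) (falses-replicate r)
    (TwistedCol.#FixedPairs≤mixedBound i (2 ^ zeros σ) (2 ^ i ∸ 2 ^ zeros σ)
      (≤-trans (≤-reflexive (card-Vec BoolFinite i)) (m≤n+m∸n (2 ^ i) (2 ^ zeros σ)))
      -- Initially every point carries the map `permute σ` itself, so all points are marked and
      -- `mixedBound` reduces to `fixedBound`.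
      (replicate r true) (λ _ → permute σ) (λ _ _ → ≤-reflexive (fixes-permute σ)))

-- Orbits and Burnside's inequality.

Carries : ∀ {i r} → Permutation′ i → Permutation′ r → Mat i r → Mat i r → Set
Carries π ρ M N = ∀ y x → entry M y x ≡ entry N (ρ ⟨$⟩ʳ y) (π ⟨$⟩ʳ x)

Carries? : ∀ {i r} (π : Permutation′ i) (ρ : Permutation′ r) M N → Dec (Carries π ρ M N)
Carries? π ρ M N = all? λ y → all? λ x → entry M y x ≟ᵇ entry N (ρ ⟨$⟩ʳ y) (π ⟨$⟩ʳ x)

carries⇒fixed : ∀ {i r} (σ : Code i) (c : Code r) M → Carries ⟦ σ ⟧ ⟦ c ⟧ M M → FixedTriple (σ , c , M)
carries⇒fixed σ c M h y = lookup-ext _ _ λ x → trans (h y x) (sym (lookup∘tabulate _ x))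

carries-encode : ∀ {i r} (π : Permutation′ i) (ρ : Permutation′ r) M N →
  Carries π ρ M N → Carries ⟦ encode π ⟧ ⟦ encode ρ ⟧ M N
carries-encode π ρ M N h y x = trans (h y x) (sym (cong₂ (entry N) (⟦encode⟧ ρ y) (⟦encode⟧ π x)))

carries-cancel : ∀ {i r} (π π′ : Permutation′ i) (ρ ρ′ : Permutation′ r) M M′ N →
  Carries π ρ M N → Carries π′ ρ′ M′ N → Carries (π ∘ₚ flipₚ π′) (ρ ∘ₚ flipₚ ρ′) M M′
carries-cancel π π′ ρ ρ′ M M′ N h h′ y x =
  trans (h y x) (sym (trans (h′ _ _) (cong₂ (entry N) (inverseʳ ρ′) (inverseʳ π′))))

carries-conjugate : ∀ {i r} (π π′ : Permutation′ i) (ρ ρ′ : Permutation′ r) M N →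
  Carries π ρ M N → Carries π′ ρ′ M N → Carries (flipₚ π′ ∘ₚ π) (flipₚ ρ′ ∘ₚ ρ) N N
carries-conjugate π π′ ρ ρ′ M N h h′ y x =
  trans (sym (trans (h′ _ _) (cong₂ (entry N) (inverseʳ ρ′) (inverseʳ π′)))) (h _ _)

image : ∀ {i r} → Permutation′ i → Permutation′ r → Mat i r → Mat i r
image π ρ M = tabulate λ y → tabulate λ x → entry M (ρ ⟨$⟩ˡ y) (π ⟨$⟩ˡ x)

entry-tabulate : ∀ {i r} (f : Fin r → Fin i → Bool) y x → entry (tabulate λ y → tabulate (f y)) y x ≡ f y x
entry-tabulate f y x = trans (cong (λ u → lookup u x) (lookup∘tabulate _ y)) (lookup∘tabulate (f y) x)

carries-image : ∀ {i r} (π : Permutation′ i) (ρ : Permutation′ r) M → Carries π ρ M (image π ρ M)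
carries-image π ρ M y x = sym (trans (entry-tabulate (λ y x → entry M (ρ ⟨$⟩ˡ y) (π ⟨$⟩ˡ x)) (ρ ⟨$⟩ʳ y) (π ⟨$⟩ʳ x)) (cong₂ (entry M) (inverseˡ ρ) (inverseˡ π)))

-- A choice of a pair carrying M to N (the identity if there is none) that depends on M and N only.
transporter : ∀ {i r} → Mat i r → Mat i r → Code i × Code r
transporter {i} {r} M N with anyᴸ? (λ g → Carries? ⟦ proj₁ g ⟧ ⟦ proj₂ g ⟧ M N) (cartesianProduct (codes i) (codes r))
... | yes p = proj₁ (satisfied p)
... | no  _ = encode idₚ , encode idₚ

transporter-carries : ∀ {i r} (σ : Code i) (c : Code r) M N → Carries ⟦ σ ⟧ ⟦ c ⟧ M N →
  Carries ⟦ proj₁ (transporter M N) ⟧ ⟦ proj₂ (transporter M N) ⟧ M N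
transporter-carries {i} {r} σ c M N h with anyᴸ? (λ g → Carries? ⟦ proj₁ g ⟧ ⟦ proj₂ g ⟧ M N) (cartesianProduct (codes i) (codes r))
... | yes p = proj₂ (satisfied p)
... | no ¬p = contradiction (lose (∈-cartesianProduct⁺ (complete (CodeFinite i) σ) (complete (CodeFinite r) c)) h) ¬p

Full : ∀ {i r} → Mat i r → Set
Full M = ∀ x → ∃ λ y → entry M y x ≡ true

Full? : ∀ {i r} (M : Mat i r) → Dec (Full M)
Full? M = all? λ x → any? λ y → entry M y x ≟ᵇ true

encode-injective : ∀ {n} (π ρ : Permutation′ n) → encode π ≡ encode ρ → ∀ x → π ⟨$⟩ʳ x ≡ ρ ⟨$⟩ʳ x
encode-injective π ρ eq x = trans (sym (⟦encode⟧ π x)) (trans (cong (λ c → ⟦ c ⟧ ⟨$⟩ʳ x) eq) (⟦encode⟧ ρ x))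

flip-cancel : ∀ {n} (τ σ σ′ : Code n) → encode (flipₚ ⟦ τ ⟧ ∘ₚ ⟦ σ ⟧) ≡ encode (flipₚ ⟦ τ ⟧ ∘ₚ ⟦ σ′ ⟧) → σ ≡ σ′
flip-cancel τ σ σ′ eq = ⟦⟧-injective σ σ′ λ x →
  subst (λ k → ⟦ σ ⟧ ⟨$⟩ʳ k ≡ ⟦ σ′ ⟧ ⟨$⟩ʳ k) (inverseˡ ⟦ τ ⟧) (encode-injective (flipₚ ⟦ τ ⟧ ∘ₚ ⟦ σ ⟧) (flipₚ ⟦ τ ⟧ ∘ₚ ⟦ σ′ ⟧) eq (⟦ τ ⟧ ⟨$⟩ʳ x))

-- If g carries M j to N, then g and the transporter t from M j to N give the stabiliser element g ∘ t⁻¹ of N, and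
-- (N , g ∘ t⁻¹) determines j and g.
module Burnside {J : Set} {i r : ℕ} (js : List J) (js-unique : Unique js) (M : J → Mat i r)
  (full : ∀ {j} → j ∈ js → Full (M j))
  (inequivalent : ∀ {j j′} → j ∈ js → j′ ∈ js → ∀ π ρ → Carries π ρ (M j) (M j′) → j ≡ j′) where

  stabilise : J × Code i × Code r → Triple i r
  stabilise (j , σ , c) = encode (flipₚ ⟦ proj₁ t ⟧ ∘ₚ ⟦ σ ⟧) , encode (flipₚ ⟦ proj₂ t ⟧ ∘ₚ ⟦ c ⟧) , N
    where
    N = image ⟦ σ ⟧ ⟦ c ⟧ (M j)
    t = transporter (M j) N

  stabilise-fixed : ∀ x → FixedTriple (stabilise x)
  stabilise-fixed (j , σ , c) = carries⇒fixed (encode π) (encode ρ) N (carries-encode π ρ N N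
      (carries-conjugate ⟦ σ ⟧ ⟦ proj₁ t ⟧ ⟦ c ⟧ ⟦ proj₂ t ⟧ (M j) N carried (transporter-carries σ c (M j) N carried)))
    where
    N = image ⟦ σ ⟧ ⟦ c ⟧ (M j)
    t = transporter (M j) N
    π = flipₚ ⟦ proj₁ t ⟧ ∘ₚ ⟦ σ ⟧
    ρ = flipₚ ⟦ proj₂ t ⟧ ∘ₚ ⟦ c ⟧
    carried : Carries ⟦ σ ⟧ ⟦ c ⟧ (M j) N
    carried = carries-image ⟦ σ ⟧ ⟦ c ⟧ (M j)

  stabilise-full : ∀ x → proj₁ x ∈ js → Full (proj₂ (proj₂ (stabilise x)))
  stabilise-full (j , σ , c) j∈ x with full j∈ (⟦ σ ⟧ ⟨$⟩ˡ x)
  ... | y , p = ⟦ c ⟧ ⟨$⟩ʳ y , trans (entry-tabulate (λ y x → entry (M j) (⟦ c ⟧ ⟨$⟩ˡ y) (⟦ σ ⟧ ⟨$⟩ˡ x)) (⟦ c ⟧ ⟨$⟩ʳ y) x)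
      (trans (cong (λ k → entry (M j) k (⟦ σ ⟧ ⟨$⟩ˡ x)) (inverseˡ ⟦ c ⟧)) p)

  stabilise-injective : ∀ {x x′} → proj₁ x ∈ js → proj₁ x′ ∈ js → stabilise x ≡ stabilise x′ → x ≡ x′
  stabilise-injective {j , σ , c} {j′ , σ′ , c′} j∈ j′∈ eq
    -- M j and M j′ are both carried to the common image, hence equivalent, so j = j′. The two
    -- transporters then coincide and cancel.
    with refl ← inequivalent j∈ j′∈ (⟦ σ ⟧ ∘ₚ flipₚ ⟦ σ′ ⟧) (⟦ c ⟧ ∘ₚ flipₚ ⟦ c′ ⟧)
           (carries-cancel ⟦ σ ⟧ ⟦ σ′ ⟧ ⟦ c ⟧ ⟦ c′ ⟧ (M j) (M j′) (image ⟦ σ ⟧ ⟦ c ⟧ (M j))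
             (carries-image ⟦ σ ⟧ ⟦ c ⟧ (M j))
             (subst (Carries ⟦ σ′ ⟧ ⟦ c′ ⟧ (M j′)) (sym (cong (proj₂ ∘ proj₂) eq)) (carries-image ⟦ σ′ ⟧ ⟦ c′ ⟧ (M j′))))
    = cong₂ (λ σ c → j , σ , c)
        (flip-cancel (proj₁ t) σ σ′ (trans (cong proj₁ eq) (cong (λ u → encode (flipₚ ⟦ proj₁ u ⟧ ∘ₚ ⟦ σ′ ⟧)) (sym t≡t′))))
        (flip-cancel (proj₂ t) c c′ (trans (cong (proj₁ ∘ proj₂) eq) (cong (λ u → encode (flipₚ ⟦ proj₂ u ⟧ ∘ₚ ⟦ c′ ⟧)) (sym t≡t′))))
    where
    t = transporter (M j) (image ⟦ σ ⟧ ⟦ c ⟧ (M j))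
    t′ = transporter (M j) (image ⟦ σ′ ⟧ ⟦ c′ ⟧ (M j))
    t≡t′ : t ≡ t′
    t≡t′ = cong (transporter (M j)) (cong (proj₂ ∘ proj₂) eq)

  orbits≤full : length js * (i ! * r !) ≤ length (filter (Full? ∘ proj₂ ∘ proj₂) (fixedTriples i r))
  orbits≤full = begin
    length js * (i ! * r !)
      ≡⟨ cong (length js *_) (trans (length-cartesianProductWith _,_ (codes i) (codes r)) (cong₂ _*_ (length-codes i) (length-codes r))) ⟨
    length js * length (cartesianProduct (codes i) (codes r))
      ≡⟨ length-cartesianProductWith _,_ js _ ⟨
    length (cartesianProduct js (cartesianProduct (codes i) (codes r)))
      ≤⟨ length-injection stabilise
           (cartesianProduct⁺ js-unique (cartesianProduct⁺ (unique (CodeFinite i)) (unique (CodeFinite r))))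
           (λ {x} x∈ → ∈-filter⁺ (Full? ∘ proj₂ ∘ proj₂) (∈-fixedTriples (stabilise-fixed x)) (stabilise-full x (j∈js x∈)))
           (λ x∈ x′∈ → stabilise-injective (j∈js x∈) (j∈js x′∈)) ⟩
    length (filter (Full? ∘ proj₂ ∘ proj₂) (fixedTriples i r)) ∎
    where
    open ≤-Reasoning
    j∈js : ∀ {x} → x ∈ cartesianProduct js (cartesianProduct (codes i) (codes r)) → proj₁ x ∈ js
    j∈js = proj₁ ∘ ∈-cartesianProduct⁻ js _

-- Fixed triples with a zero row.

-- A graph with a new isolated vertex x, together with the swap of x and a fixed choice of an isolated vertex.
module NonFull (i r : ℕ) where

  Zero : Mat (suc i) r → Fin (suc i) → Set
  Zero M x = ∀ y → entry M y x ≡ false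

  someZero : Mat (suc i) r → Fin (suc i)
  someZero M with any? (λ x → all? λ y → entry M y x ≟ᵇ false)
  ... | yes (x , _) = x
  -- Default for matrices without a zero row; `extend` calls `someZero` only after inserting one.
  ... | no  _       = zero

  someZero-zero : ∀ M {x} → Zero M x → Zero M (someZero M)
  someZero-zero M {x} h with any? (λ x → all? λ y → entry M y x ≟ᵇ false)
  ... | yes (_ , p) = p
  ... | no  ¬p      = contradiction (x , h) ¬p

  insertZero : Fin (suc i) → Mat i r → Mat (suc i) r
  insertZero x = mapᵛ λ v → insertAt v x false

  insertZero-zero : ∀ x M → Zero (insertZero x M) x
  insertZero-zero x M y = trans (cong (λ v → lookup v x) (lookup-map y _ M)) (insertAt-lookup (lookup M y) x false)

  insertZero-injective : ∀ x M M′ → insertZero x M ≡ insertZero x M′ → M ≡ M′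
  insertZero-injective x M M′ eq = lookup-ext M M′ λ y → begin
    lookup M y                                  ≡⟨ removeAt-insertAt (lookup M y) x false ⟨
    removeAt (insertAt (lookup M y) x false) x  ≡⟨ cong (λ v → removeAt v x) (lookup-map y _ M) ⟨
    removeAt (lookup (insertZero x M) y) x      ≡⟨ cong (λ N → removeAt (lookup N y) x) eq ⟩
    removeAt (lookup (insertZero x M′) y) x     ≡⟨ cong (λ v → removeAt v x) (lookup-map y _ M′) ⟩
    removeAt (insertAt (lookup M′ y) x false) x ≡⟨ removeAt-insertAt (lookup M′ y) x false ⟩
    lookup M′ y                                 ∎
    where open ≡-Reasoning

  transpose-cases : ∀ {n} (a b x : Fin n) →
    transpose a b ⟨$⟩ʳ x ≡ x ⊎ ((x ≡ a ⊎ x ≡ b) × (transpose a b ⟨$⟩ʳ x ≡ a ⊎ transpose a b ⟨$⟩ʳ x ≡ b))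
  transpose-cases a b x with x ≟ a
  ... | yes x≡a = inj₂ (inj₁ x≡a , inj₂ refl)
  ... | no _ with x ≟ b
  ...   | yes x≡b = inj₂ (inj₂ x≡b , inj₁ refl)
  ...   | no _    = inj₁ refl

  transpose-right : ∀ {n} (a b : Fin n) → transpose a b ⟨$⟩ʳ b ≡ a
  transpose-right a b with b ≟ a
  ... | yes b≡a = b≡a
  ... | no _ rewrite dec-true (b ≟ b) refl = refl

  IdFixed? : ∀ (p : Code r × Mat i r) → Dec (TwistedCol.Fixed i (proj₁ p) (λ _ v → v) (proj₂ p))
  IdFixed? (c , M) = TwistedCol.Fixed? i c (λ _ v → v) M

  pairs : List (Code r × Mat i r)
  pairs = cartesianProduct (codes r) (elems (MatFinite i r))

  source : List (Fin (suc i) × Code r × Mat i r)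
  source = cartesianProduct (allFin (suc i)) (filter IdFixed? pairs)

  length-source : length source ≡ suc i * rising (2 ^ i) r
  length-source = trans (length-cartesianProductWith _,_ (allFin (suc i)) (filter IdFixed? pairs)) (cong₂ _*_ (length-allFin (suc i)) (begin
    length (filter IdFixed? pairs)                  ≡⟨ length-filter≡∑ IdFixed? pairs ⟩
    ∑ pairs (𝟙 ∘ IdFixed?)                          ≡⟨ ∑-cartesianProductWith _,_ (codes r) (elems (MatFinite i r)) _ ⟩
    TwistedCol.#FixedPairs i {r} (λ _ v → v)        ≡⟨ TwistedCol.#FixedPairs-id i {r} (λ _ v → v) (λ _ _ → refl) ⟩
    rising (card (ColFinite i)) r                   ≡⟨ cong (λ N → rising N r) (card-Vec BoolFinite i) ⟩
    rising (2 ^ i) r                                ∎))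
    where open ≡-Reasoning

  extend : Fin (suc i) × Code r × Mat i r → Triple (suc i) r
  extend (x , c , M) = encode (transpose x (someZero N)) , c , N
    where N = insertZero x M

  -- Both rows exchanged by the swap are zero, so it leaves N unchanged, and inserting the same zero
  -- into every column preserves invariance under c.
  extend-fixed : ∀ x c M → TwistedCol.Fixed i c (λ _ v → v) M → FixedTriple (extend (x , c , M))
  extend-fixed x c M h = carries⇒fixed (encode τ) c N λ y x′ → begin
    entry N y x′                                          ≡⟨ cong (λ v → lookup v x′) (column y) ⟩
    entry N (⟦ c ⟧ ⟨$⟩ʳ y) x′                             ≡⟨ zeros-swap (⟦ c ⟧ ⟨$⟩ʳ y) x′ ⟩
    entry N (⟦ c ⟧ ⟨$⟩ʳ y) (τ ⟨$⟩ʳ x′)                    ≡⟨ cong (entry N (⟦ c ⟧ ⟨$⟩ʳ y)) (⟦encode⟧ τ x′) ⟨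
    entry N (⟦ c ⟧ ⟨$⟩ʳ y) (⟦ encode τ ⟧ ⟨$⟩ʳ x′)         ∎
    where
    open ≡-Reasoning
    N = insertZero x M
    f = someZero N
    τ = transpose x f
    column : ∀ y → lookup N y ≡ lookup N (⟦ c ⟧ ⟨$⟩ʳ y)
    column y = trans (lookup-map y _ M) (trans (cong (λ v → insertAt v x false) (h y)) (sym (lookup-map _ _ M)))
    isZero : ∀ {x′} → x′ ≡ x ⊎ x′ ≡ f → Zero N x′
    isZero (inj₁ refl) = insertZero-zero x M
    isZero (inj₂ refl) = someZero-zero N (insertZero-zero x M)
    zeros-swap : ∀ y x′ → entry N y x′ ≡ entry N y (τ ⟨$⟩ʳ x′)
    zeros-swap y x′ with transpose-cases x f x′
    ... | inj₁ eq      = cong (entry N y) (sym eq)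
    ... | inj₂ (p , q) = trans (isZero p y) (sym (isZero q y))

  extend-nonfull : ∀ t → ¬ Full (proj₂ (proj₂ (extend t)))
  extend-nonfull (x , c , M) full with full x
  ... | y , p = contradiction (trans (sym (insertZero-zero x M y)) p) λ ()

  -- The swap sends the chosen isolated vertex to the inserted one, so the pair (swap, N) recovers x.
  extend-injective : ∀ {t t′} → extend t ≡ extend t′ → t ≡ t′
  extend-injective {x , c , M} {x′ , c′ , M′} eq = recover x≡x′ (cong (proj₁ ∘ proj₂) eq) N≡N′
    where
    open ≡-Reasoning
    N = insertZero x M
    N′ = insertZero x′ M′
    N≡N′ : N ≡ N′
    N≡N′ = cong (proj₂ ∘ proj₂) eq
    x≡x′ : x ≡ x′
    x≡x′ = begin
      x                                             ≡⟨ transpose-right x (someZero N) ⟨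
      transpose x (someZero N) ⟨$⟩ʳ someZero N      ≡⟨ encode-injective (transpose x (someZero N)) (transpose x′ (someZero N′)) (cong proj₁ eq) (someZero N) ⟩
      transpose x′ (someZero N′) ⟨$⟩ʳ someZero N    ≡⟨ cong (λ K → transpose x′ (someZero N′) ⟨$⟩ʳ someZero K) N≡N′ ⟩
      transpose x′ (someZero N′) ⟨$⟩ʳ someZero N′   ≡⟨ transpose-right x′ (someZero N′) ⟩
      x′                                            ∎
    recover : ∀ {x x′} {c c′ : Code r} → x ≡ x′ → c ≡ c′ → insertZero x M ≡ insertZero x′ M′ → (x , c , M) ≡ (x′ , c′ , M′)
    recover {x} {c = c} refl refl p = cong (λ M → x , c , M) (insertZero-injective x M M′ p)

  source≤nonfull : suc i * rising (2 ^ i) r ≤ length (filter (¬? ∘ Full? ∘ proj₂ ∘ proj₂) (fixedTriples (suc i) r))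
  source≤nonfull = ≤-trans (≤-reflexive (sym length-source)) (length-injection extend
    (cartesianProduct⁺ (allFin⁺ (suc i)) (Unique-filter⁺ IdFixed? (cartesianProduct⁺ (unique (CodeFinite r)) (unique (MatFinite i r)))))
    (λ {t@(x , c , M)} t∈ → ∈-filter⁺ (¬? ∘ Full? ∘ proj₂ ∘ proj₂)
      (∈-fixedTriples (extend-fixed x c M (proj₂ (∈-filter⁻ IdFixed? {xs = pairs} (proj₂ (∈-cartesianProduct⁻ (allFin (suc i)) (filter IdFixed? pairs) t∈))))))
      (extend-nonfull t))
    (λ _ _ → extend-injective))

-- The fixed triples split into those with and those without a zero row; each kind is bounded below,
-- their total above.
fullClasses-bound : ∀ {J : Set} i r → suc i < r → (js : List J) → Unique js → (M : J → Mat (suc i) r) →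
  (∀ {j} → j ∈ js → Full (M j)) →
  (∀ {j j′} → j ∈ js → j′ ∈ js → ∀ π ρ → Carries π ρ (M j) (M j′) → j ≡ j′) →
  length js * (suc i ! * r !) + suc i * rising (2 ^ i) r ≤ 2 * rising (2 ^ suc i) r
fullClasses-bound i r i<r js u M full ineq = ≤-trans
  (+-mono-≤ (Burnside.orbits≤full js u M full ineq) (NonFull.source≤nonfull i r))
  (≤-trans (≤-reflexive (length-filter-split (Full? ∘ proj₂ ∘ proj₂) (fixedTriples (suc i) r)))
           (length-fixedTriples (suc i) r i<r))

-- From natural numbers to the rational bound.

-- In scope only from here on, since +_ would make sections of _+_ ambiguous.
open import Data.Integer using (+_)

rising*! : ∀ M r → rising (suc M) r * M ! ≡ (r + M) !
rising*! M zero    = +-identityʳ (M !)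
rising*! M (suc r) = trans (*-assoc (suc M + r) (rising (suc M) r) (M !))
  (cong₂ _*_ (cong suc (+-comm M r)) (rising*! M r))

rising≡!*C : ∀ N r → .{{_ : NonZero N}} → rising N r ≡ r ! * ((r + N ∸ 1) C r)
rising≡!*C (suc M) r rewrite +-suc r M = *-cancelʳ-≡ _ _ (M !) {{M !≢0}} (begin
  rising (suc M) r * M !               ≡⟨ rising*! M r ⟩
  (r + M) !                            ≡⟨ m*[n/m]≡n (k![n∸k]!∣n! (m≤m+n r M)) ⟨
  r ! * (r + M ∸ r) ! * ((r + M) ! / (r ! * (r + M ∸ r) !)) ≡⟨ cong (r ! * (r + M ∸ r) ! *_) (nCk≡n!/k![n-k]! (m≤m+n r M)) ⟨
  r ! * (r + M ∸ r) ! * ((r + M) C r)  ≡⟨ cong (λ k → r ! * k ! * ((r + M) C r)) (m+n∸m≡n r M) ⟩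
  r ! * M ! * ((r + M) C r)            ≡⟨ lem (r !) (M !) ((r + M) C r) ⟩
  r ! * ((r + M) C r) * M !            ∎)
  where
  open ≡-Reasoning
  instance
    _ = r !* (r + M ∸ r) !≢0
  lem : ∀ x y z → x * y * z ≡ x * z * y
  lem = solve-∀

nC0≡1 : ∀ n → n C 0 ≡ 1
nC0≡1 n = trans (nCk≡nC[n∸k] {0} {n} z≤n) (nCn≡1 n)

fromℕ-+ : ∀ a b → fromℕ (a + b) ≡ fromℕ a ℚ.+ fromℕ b
fromℕ-+ a b = ℚ.toℚᵘ-injective (ℚᵘ.≃-trans (ℚ.toℚᵘ-fromℚᵘ (mkℚᵘ (+ (a + b)) 0)) (ℚᵘ.≃-sym
  (ℚᵘ.≃-trans (ℚ.toℚᵘ-homo-+ (fromℕ a) (fromℕ b))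
  (ℚᵘ.≃-trans (ℚᵘ.+-cong (ℚ.toℚᵘ-fromℚᵘ (mkℚᵘ (+ a) 0)) (ℚ.toℚᵘ-fromℚᵘ (mkℚᵘ (+ b) 0)))
    (*≡* (cong (ℤ._* + 1) (cong₂ ℤ._+_ (ℤ.*-identityʳ (+ a)) (ℤ.*-identityʳ (+ b)))))))))

-- Over the common denominator d = c d′ the left side has numerator k d + c Y.
fraction-bound : ∀ k c X Y d d′ .{{_ : NonZero d}} .{{_ : NonZero d′}} → d ≡ c * d′ →
  k * d + c * Y ≤ X → fromℕ k ℚ.+ (+ Y ℚ./ d′) ℚ.≤ (+ X ℚ./ d)
fraction-bound k c X Y d@(suc p) d′@(suc q) d≡cd′ h = ℚ.toℚᵘ-cancel-≤
  (ℚᵘ.≤-respˡ-≃ (ℚᵘ.≃-sym (ℚᵘ.≃-trans (ℚ.toℚᵘ-homo-+ (fromℕ k) (+ Y ℚ./ d′))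
      (ℚᵘ.+-cong (ℚ.toℚᵘ-fromℚᵘ (mkℚᵘ (+ k) 0)) (ℚ.toℚᵘ-fromℚᵘ (mkℚᵘ (+ Y) q)))))
  (ℚᵘ.≤-respʳ-≃ (ℚᵘ.≃-sym (ℚ.toℚᵘ-fromℚᵘ (mkℚᵘ (+ X) p)))
    (*≤* (subst₂ ℤ._≤_ lhs rhs (+≤+ main)))))
  where
  -- The factors 1 are the denominator of `fromℕ k`, as they arise in the sum of unnormalised
  -- fractions.
  main : (k * d′ + Y * 1) * d ≤ X * (1 * d′)
  main = begin
    (k * d′ + Y * 1) * d          ≡⟨ cong ((k * d′ + Y * 1) *_) d≡cd′ ⟩
    (k * d′ + Y * 1) * (c * d′)   ≡⟨ lem k d′ Y c ⟩
    (k * (c * d′) + c * Y) * (1 * d′) ≡⟨ cong (λ z → (k * z + c * Y) * (1 * d′)) d≡cd′ ⟨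
    (k * d + c * Y) * (1 * d′)    ≤⟨ *-monoˡ-≤ (1 * d′) h ⟩
    X * (1 * d′)                  ∎
    where
    open ≤-Reasoning
    lem : ∀ k d Y c → (k * d + Y * 1) * (c * d) ≡ (k * (c * d) + c * Y) * (1 * d)
    lem = solve-∀
  lhs : + ((k * d′ + Y * 1) * d) ≡ (+ k ℤ.* + d′ ℤ.+ + Y ℤ.* + 1) ℤ.* + d
  lhs = trans (ℤ.pos-* (k * d′ + Y * 1) d) (cong (ℤ._* + d)
    (trans (ℤ.pos-+ (k * d′) (Y * 1)) (cong₂ ℤ._+_ (ℤ.pos-* k d′) (ℤ.pos-* Y 1))))
  rhs : + (X * (1 * d′)) ≡ + X ℤ.* + (1 * d′)
  rhs = ℤ.pos-* X (1 * d′)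

bracket : ℕ → ℕ → ℚ
bracket r j = ((+ (2 * ((r + 2 ^ suc j ∸ 1) C r))) ℚ./ (suc j !)) {{suc j !≢0}}
  ℚ.- ((+ ((r + 2 ^ j ∸ 1) C r)) ℚ./ (j !)) {{j !≢0}}

-- Division by (j + 1)! r!. The j + 1 positions of the inserted row reduce (j + 1)! to j! in the
-- subtracted term.
≤-bracket : ∀ k r j → k * (suc j ! * r !) + suc j * rising (2 ^ j) r ≤ 2 * rising (2 ^ suc j) r →
  fromℕ k ℚ.≤ bracket r j
≤-bracket k r j h = begin
  fromℕ k                          ≡⟨ cancel (fromℕ k) v/j! ⟩
  fromℕ k ℚ.+ v/j! ℚ.- v/j!        ≤⟨ ℚ.+-monoˡ-≤ (ℚ.- v/j!) (fraction-bound k (suc j) (2 * u) v (suc j !) (j !) refl (*-cancelʳ-≤ _ _ (r !) scaled)) ⟩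
  bracket r j                      ∎
  where
  open ℚ.≤-Reasoning
  instance
    _ = suc j !≢0
    _ = j !≢0
    _ = r !≢0
    _ = m^n≢0 2 j
    _ = m^n≢0 2 (suc j)
  u = (r + 2 ^ suc j ∸ 1) C r
  v = (r + 2 ^ j ∸ 1) C r
  v/j! = + v ℚ./ (j !)
  cancel : ∀ p q → p ≡ p ℚ.+ q ℚ.- q
  cancel = +-*-Solver.solve 2 (λ p q → p +-*-Solver.:= p +-*-Solver.:+ q +-*-Solver.:- q) refl
  scaled : (k * suc j ! + suc j * v) * r ! ≤ 2 * u * r !
  scaled = subst₂ _≤_
    (trans (cong (λ z → k * (suc j ! * r !) + suc j * z) (rising≡!*C (2 ^ j) r)) (lem₁ k (suc j !) (r !) (suc j) v))
    (trans (cong (2 *_) (rising≡!*C (2 ^ suc j) r)) (lem₂ (r !) u)) h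
    where
    lem₁ : ∀ k a b c v → k * (a * b) + c * (b * v) ≡ (k * a + c * v) * b
    lem₁ = solve-∀
    lem₂ : ∀ b u → 2 * (b * u) ≡ 2 * u * b
    lem₂ = solve-∀

∑ℚ : ℕ → (ℕ → ℚ) → ℚ
∑ℚ zero    g = 0ℚ
∑ℚ (suc m) g = ∑ℚ m g ℚ.+ g m

∑ℚ-cong : ∀ m {f g} → (∀ j → f j ≡ g j) → ∑ℚ m f ≡ ∑ℚ m g
∑ℚ-cong zero    h = refl
∑ℚ-cong (suc m) h = cong₂ ℚ._+_ (∑ℚ-cong m h) (h m)

∑ℚ-+ : ∀ m f g → ∑ℚ m (λ j → f j ℚ.+ g j) ≡ ∑ℚ m f ℚ.+ ∑ℚ m g
∑ℚ-+ zero    f g = refl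
∑ℚ-+ (suc m) f g = trans (cong (ℚ._+ (f m ℚ.+ g m)) (∑ℚ-+ m f g)) (lem (∑ℚ m f) (∑ℚ m g) (f m) (g m))
  where
  lem : ∀ a b c d → (a ℚ.+ b) ℚ.+ (c ℚ.+ d) ≡ (a ℚ.+ c) ℚ.+ (b ℚ.+ d)
  lem = +-*-Solver.solve 4 (λ a b c d → (a :+ b) :+ (c :+ d) := (a :+ c) :+ (b :+ d)) refl
    where open +-*-Solver

∑ℚ-shift : ∀ m g → ∑ℚ (suc m) g ≡ g 0 ℚ.+ ∑ℚ m (g ∘ suc)
∑ℚ-shift zero    g = ℚ.+-comm 0ℚ (g 0)
∑ℚ-shift (suc m) g = trans (cong (ℚ._+ g (suc m)) (∑ℚ-shift m g)) (ℚ.+-assoc (g 0) _ _)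

-- Summation over subsets.

-- The sum of f ∣S∣ over the subsets S of an n-element set.
subsetSum : ℕ → (ℕ → ℚ) → ℚ
subsetSum zero    f = f 0
subsetSum (suc n) f = subsetSum n f ℚ.+ subsetSum n (f ∘ suc)

subsetSum-binomial : ∀ n f → subsetSum n f ≡ ∑ℚ (suc n) (λ j → fromℕ (n C j) ℚ.* f j)
subsetSum-binomial zero    f = sym (trans (ℚ.+-identityˡ _) (ℚ.*-identityˡ (f 0)))
subsetSum-binomial (suc n) f = begin
  subsetSum n f ℚ.+ subsetSum n (f ∘ suc)
    ≡⟨ cong₂ ℚ._+_ (subsetSum-binomial n f) (subsetSum-binomial n (f ∘ suc)) ⟩
  ∑ℚ (suc n) (term n) ℚ.+ S
    ≡⟨ cong (ℚ._+ S) (ℚ.+-identityʳ (∑ℚ (suc n) (term n))) ⟨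
  ∑ℚ (suc n) (term n) ℚ.+ 0ℚ ℚ.+ S
    -- The vanishing term with n C (n + 1) is appended, so that after the shift both sums have n + 1
    -- terms and Pascal's rule applies termwise.
    ≡⟨ cong (λ z → ∑ℚ (suc n) (term n) ℚ.+ z ℚ.+ S) (trans (cong (λ z → fromℕ z ℚ.* f (suc n)) (k>n⇒nCk≡0 (n<1+n n))) (ℚ.*-zeroˡ (f (suc n)))) ⟨
  ∑ℚ (suc (suc n)) (term n) ℚ.+ S
    ≡⟨ cong (ℚ._+ S) (∑ℚ-shift (suc n) (term n)) ⟩
  term n 0 ℚ.+ ∑ℚ (suc n) (term n ∘ suc) ℚ.+ S
    ≡⟨ lem (term n 0) (∑ℚ (suc n) (term n ∘ suc)) S ⟩
  term n 0 ℚ.+ (S ℚ.+ ∑ℚ (suc n) (term n ∘ suc))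
    ≡⟨ cong (term n 0 ℚ.+_) (∑ℚ-+ (suc n) _ (term n ∘ suc)) ⟨
  term n 0 ℚ.+ ∑ℚ (suc n) (λ j → fromℕ (n C j) ℚ.* f (suc j) ℚ.+ term n (suc j))
    ≡⟨ cong₂ ℚ._+_ (cong (λ z → fromℕ z ℚ.* f 0) (trans (nC0≡1 n) (sym (nC0≡1 (suc n))))) (∑ℚ-cong (suc n) pascal) ⟩
  term (suc n) 0 ℚ.+ ∑ℚ (suc n) (term (suc n) ∘ suc)
    ≡⟨ ∑ℚ-shift (suc n) (term (suc n)) ⟨
  ∑ℚ (suc (suc n)) (term (suc n)) ∎
  where
  open ≡-Reasoning
  term : ℕ → ℕ → ℚ
  term n j = fromℕ (n C j) ℚ.* f j
  S = ∑ℚ (suc n) (λ j → fromℕ (n C j) ℚ.* f (suc j))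
  lem : ∀ a b c → (a ℚ.+ b) ℚ.+ c ≡ a ℚ.+ (c ℚ.+ b)
  lem = +-*-Solver.solve 3 (λ a b c → (a :+ b) :+ c := a :+ (c :+ b)) refl
    where open +-*-Solver
  pascal : ∀ j → fromℕ (n C j) ℚ.* f (suc j) ℚ.+ term n (suc j) ≡ term (suc n) (suc j)
  pascal j = trans (sym (ℚ.*-distribʳ-+ (f (suc j)) (fromℕ (n C j)) (fromℕ (n C suc j))))
    (cong (ℚ._* f (suc j)) (trans (sym (fromℕ-+ (n C j) (n C suc j))) (cong fromℕ (nCk+nC[k+1]≡[n+1]C[k+1] n j))))

-- The value at `zero` is the leading 1 of the bound: the class of the edgeless graph.
classBound : ℕ → ℕ → ℚ
classBound r zero    = 1ℚ
classBound r (suc j) = bracket r j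

subsetSum≡bound : ∀ n r → subsetSum n (classBound r) ≡ bound n r
subsetSum≡bound n r = trans (subsetSum-binomial n (classBound r)) (trans (∑ℚ-shift n _)
  (cong₂ ℚ._+_ (trans (cong (λ z → fromℕ z ℚ.* 1ℚ) (nC0≡1 n)) (ℚ.*-identityʳ (fromℕ 1))) (sums n)))
  where
  sums : ∀ m → ∑ℚ m (summand n r) ≡ sumTo n r m
  sums zero    = refl
  sums (suc m) = cong (ℚ._+ summand n r m) (sums m)

-- Graphs with a prescribed connected domain.

embed : ∀ {n} (S : Vec Bool n) → Fin (trues S) → Fin n
embed (true ∷ S)  zero    = zero
embed (true ∷ S)  (suc z) = suc (embed S z)
embed (false ∷ S) z       = suc (embed S z)

embed-injective : ∀ {n} (S : Vec Bool n) {z w} → embed S z ≡ embed S w → z ≡ w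
embed-injective (true ∷ S)  {zero}  {zero}  eq = refl
embed-injective (true ∷ S)  {suc z} {suc w} eq = cong suc (embed-injective S (suc-injective eq))
embed-injective (false ∷ S) eq = embed-injective S (suc-injective eq)

lookup-embed : ∀ {n} (S : Vec Bool n) z → lookup S (embed S z) ≡ true
lookup-embed (true ∷ S)  zero    = refl
lookup-embed (true ∷ S)  (suc z) = lookup-embed S z
lookup-embed (false ∷ S) z       = lookup-embed S z

locate : ∀ {n} (S : Vec Bool n) x → (∃ λ z → embed S z ≡ x) ⊎ lookup S x ≡ false
locate (true ∷ S)  zero    = inj₁ (zero , refl)
locate (false ∷ S) zero    = inj₂ refl
locate (true ∷ S)  (suc x) with locate S x
... | inj₁ (z , eq) = inj₁ (suc z , cong suc eq)
... | inj₂ eq       = inj₂ eq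
locate (false ∷ S) (suc x) with locate S x
... | inj₁ (z , eq) = inj₁ (z , cong suc eq)
... | inj₂ eq       = inj₂ eq

trues≤n : ∀ {n} (S : Vec Bool n) → trues S ≤ n
trues≤n []          = z≤n
trues≤n (true ∷ S)  = s≤s (trues≤n S)
trues≤n (false ∷ S) = m≤n⇒m≤1+n (trues≤n S)

module _ {n} (S : Vec Bool n) where

  extendFun : (Fin (trues S) → Fin (trues S)) → Fin n → Fin n
  extendFun f x with locate S x
  ... | inj₁ (z , _) = embed S (f z)
  ... | inj₂ _       = x

  extendFun-embed : ∀ f z → extendFun f (embed S z) ≡ embed S (f z)
  extendFun-embed f z with locate S (embed S z)
  ... | inj₁ (w , eq) = cong (embed S ∘ f) (embed-injective S eq)
  ... | inj₂ eq       = contradiction (trans (sym (lookup-embed S z)) eq) λ ()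

  extendFun-outside : ∀ f {x} → lookup S x ≡ false → extendFun f x ≡ x
  extendFun-outside f {x} out with locate S x
  ... | inj₁ (z , refl) = contradiction (trans (sym (lookup-embed S z)) out) λ ()
  ... | inj₂ _          = refl

  extendFun-inverse : ∀ f g → (∀ z → f (g z) ≡ z) → ∀ x → extendFun f (extendFun g x) ≡ x
  extendFun-inverse f g fg x with locate S x
  ... | inj₁ (z , refl) = trans (extendFun-embed f (g z)) (cong (embed S) (fg z))
  ... | inj₂ out        = extendFun-outside f out

  extendPerm : Permutation′ (trues S) → Permutation′ n
  extendPerm π = permutation (extendFun (π ⟨$⟩ʳ_)) (extendFun (π ⟨$⟩ˡ_))
    (extendFun-inverse (π ⟨$⟩ʳ_) (π ⟨$⟩ˡ_) (λ _ → inverseʳ π))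
    (extendFun-inverse (π ⟨$⟩ˡ_) (π ⟨$⟩ʳ_) (λ _ → inverseˡ π))

InConnDom? : ∀ {n r} (G : BGraph n r) x → Dec (InConnDom G x)
InConnDom? G x = any? λ y → G x y ≟ᵇ true

domain : ∀ {n r} → BGraph n r → Vec Bool n
domain G = tabulate (does ∘ InConnDom? G)

∈domain⇒InConnDom : ∀ {n r} (G : BGraph n r) x → lookup (domain G) x ≡ true → InConnDom G x
∈domain⇒InConnDom G x eq with InConnDom? G x | trans (sym (lookup∘tabulate (does ∘ InConnDom? G) x)) eq
... | yes p | _ = p

InConnDom⇒∈domain : ∀ {n r} (G : BGraph n r) x → InConnDom G x → lookup (domain G) x ≡ true
InConnDom⇒∈domain G x p = trans (lookup∘tabulate (does ∘ InConnDom? G) x) (dec-true (InConnDom? G x) p)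

∉domain⇒false : ∀ {n r} (G : BGraph n r) x y → lookup (domain G) x ≡ false → G x y ≡ false
∉domain⇒false G x y eq = ¬-not λ p → contradiction (trans (sym eq) (InConnDom⇒∈domain G x (y , p))) λ ()

restrict : ∀ {n r} (S : Vec Bool n) → BGraph n r → Mat (trues S) r
restrict S G = tabulate λ y → tabulate λ z → G (embed S z) y

restrict-full : ∀ {n r} (G : BGraph n r) S → domain G ≡ S → Full (restrict S G)
restrict-full G S refl z with ∈domain⇒InConnDom G (embed S z) (lookup-embed S z)
... | y , p = y , trans (entry-tabulate (λ y z → G (embed S z) y) y z) p

-- π is extended by the identity outside S, where neither graph has an edge.
carries⇒LSLEquiv : ∀ {n r} (G G′ : BGraph n r) S → domain G ≡ S → domain G′ ≡ S → ∀ π ρ →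
  Carries π ρ (restrict S G) (restrict S G′) → LSLEquiv G G′
carries⇒LSLEquiv G G′ S dom dom′ π ρ h =
  (extendPerm S π , ρ , λ x y → mk⇔ (trans (sym (same x y))) (trans (same x y))) ,
  λ x → mk⇔ (λ p → ∈domain⇒InConnDom G′ x (subst (λ D → lookup D x ≡ true) (trans dom (sym dom′)) (InConnDom⇒∈domain G x p)))
            (λ p → ∈domain⇒InConnDom G x (subst (λ D → lookup D x ≡ true) (trans dom′ (sym dom)) (InConnDom⇒∈domain G′ x p)))
  where
  same : ∀ x y → G x y ≡ G′ (extendPerm S π ⟨$⟩ʳ x) (ρ ⟨$⟩ʳ y)
  same x y with locate S x
  ... | inj₁ (z , refl) = begin
    G (embed S z) y                                  ≡⟨ entry-tabulate (λ y z → G (embed S z) y) y z ⟨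
    entry (restrict S G) y z                         ≡⟨ h y z ⟩
    entry (restrict S G′) (ρ ⟨$⟩ʳ y) (π ⟨$⟩ʳ z)      ≡⟨ entry-tabulate (λ y z → G′ (embed S z) y) (ρ ⟨$⟩ʳ y) (π ⟨$⟩ʳ z) ⟩
    G′ (embed S (π ⟨$⟩ʳ z)) (ρ ⟨$⟩ʳ y)               ∎
    where open ≡-Reasoning
  ... | inj₂ out = trans (∉domain⇒false G x y (subst (λ D → lookup D x ≡ false) (sym dom) out))
                         (sym (∉domain⇒false G′ x (ρ ⟨$⟩ʳ y) (subst (λ D → lookup D x ≡ false) (sym dom′) out)))

classes-bound : ∀ {J : Set} m r → m < r → (js : List J) → Unique js → (M : J → Mat m r) →
  (∀ {j} → j ∈ js → Full (M j)) →
  (∀ {j j′} → j ∈ js → j′ ∈ js → ∀ π ρ → Carries π ρ (M j) (M j′) → j ≡ j′) →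
  fromℕ (length js) ℚ.≤ classBound r m
classes-bound zero    r m<r []           u M full ineq = ℚ.<⇒≤ (ℚ.positive⁻¹ ℚ.1ℚ)
classes-bound zero    r m<r (j ∷ [])     u M full ineq = ℚ.≤-refl
-- Matrices without rows are carried to each other vacuously, so two distinct members cannot occur.
classes-bound zero    r m<r (j ∷ j′ ∷ _) ((j≢j′ ∷ _) ∷ _) M full ineq =
  contradiction (ineq (here refl) (there (here refl)) idₚ idₚ λ _ ()) j≢j′
classes-bound (suc i) r m<r js u M full ineq =
  ≤-bracket (length js) r i (fullClasses-bound i r m<r js u M full ineq)

-- The family is split by the first bit of its labels. D collects the bits already split off, from
-- which the full label is reassembled for the hypothesis on fibres.
length≤subsetSum : ∀ {J : Set} n f (D : J → Set) (ℓ : J → Vec Bool n) js → Unique js → (∀ {j} → j ∈ js → D j) →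
  (∀ S js′ → Unique js′ → (∀ {j} → j ∈ js′ → D j × ℓ j ≡ S) → fromℕ (length js′) ℚ.≤ f (trues S)) →
  fromℕ (length js) ℚ.≤ subsetSum n f
length≤subsetSum zero    f D ℓ js u d h = h [] js u λ {j} j∈ → d j∈ , empty (ℓ j)
  where
  empty : (v : Vec Bool 0) → v ≡ []
  empty [] = refl
length≤subsetSum {J} (suc n) f D ℓ js u d h = begin
  fromℕ (length js)                                                ≡⟨ cong fromℕ (length-filter-split inside? js) ⟨
  fromℕ (length (filter inside? js) + length (filter outside? js)) ≡⟨ cong fromℕ (+-comm (length (filter inside? js)) _) ⟩
  fromℕ (length (filter outside? js) + length (filter inside? js)) ≡⟨ fromℕ-+ (length (filter outside? js)) _ ⟩
  fromℕ (length (filter outside? js)) ℚ.+ fromℕ (length (filter inside? js))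
    ≤⟨ ℚ.+-mono-≤
         (length≤subsetSum n f (λ j → D j × head (ℓ j) ≡ false) (tail ∘ ℓ) (filter outside? js) (Unique-filter⁺ outside? u)
           (λ j∈ → let j∈js , p = ∈-filter⁻ outside? {xs = js} j∈ in d j∈js , ¬-not p)
           (λ S js′ u′ h′ → h (false ∷ S) js′ u′ λ {j} j∈ → let (dj , p) , q = h′ j∈ in dj , cons (ℓ j) p q))
         (length≤subsetSum n (f ∘ suc) (λ j → D j × head (ℓ j) ≡ true) (tail ∘ ℓ) (filter inside? js) (Unique-filter⁺ inside? u)
           (λ j∈ → let j∈js , p = ∈-filter⁻ inside? {xs = js} j∈ in d j∈js , p)
           (λ S js′ u′ h′ → h (true ∷ S) js′ u′ λ {j} j∈ → let (dj , p) , q = h′ j∈ in dj , cons (ℓ j) p q)) ⟩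
  subsetSum n f ℚ.+ subsetSum n (f ∘ suc) ∎
  where
  open ℚ.≤-Reasoning
  inside? : ∀ j → Dec (head (ℓ j) ≡ true)
  inside? j = head (ℓ j) ≟ᵇ true
  outside? : ∀ j → Dec (¬ head (ℓ j) ≡ true)
  outside? = ¬? ∘ inside?
  cons : ∀ (v : Vec Bool (suc n)) {b S} → head v ≡ b → tail v ≡ S → v ≡ b ∷ S
  cons (_ ∷ _) refl refl = refl

theorem3 : ∀ (n r : ℕ) → 1 ≤ n → n < r → ClassCount≤ n r (bound n r)
theorem3 n r _ n<r k G inequivalent = subst₂ (λ l b → fromℕ l ℚ.≤ b) (length-allFin k) (subsetSum≡bound n r)
  -- Each graph is labelled by its connected domain S, and the size of S is at most n, hence below r
  -- as the count of fixed triples requires.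
  (length≤subsetSum n (classBound r) (λ _ → ⊤) (domain ∘ G) (allFin k) (allFin⁺ k) (λ _ → tt)
    λ S js u dom → classes-bound (trues S) r (<-≤-trans (s≤s (trues≤n S)) n<r) js u (restrict S ∘ G)
      (λ {j} j∈ → restrict-full (G j) S (proj₂ (dom j∈)))
      (λ {j} {j′} j∈ j′∈ π ρ c → inequivalent j j′
        (carries⇒LSLEquiv (G j) (G j′) S (proj₂ (dom j∈)) (proj₂ (dom j′∈)) π ρ c)))
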